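{- Let $G$ be a graph with $n$ vertices and $k$ edges. Then $\beta(G)=n-\frac{2k}{n}$ holds if and only if $G$ is the empty (edgeless) graph or $G$ is a complete multipartite graph all of whose parts have the same size.
   Context: All graphs are finite and simple. For a graph $H$, $c_i(H)$ is the number of cliques of size $i$ ($c_0=1$), $\omega(H)$ the clique number, $PC(H,x)=\sum_{i=0}^{\omega(H)}(-1)^ic_i(H)x^{\omega(H)-i}$, and $\beta(H)$ its largest real root. (It is known that always $\beta(G)\ge n-\frac{2k}{n}$.) -}

module Defs where

open import Data.Bool using (Bool; true; false; _∧_; _∨_; not; T; T?)
open import Data.Nat as ℕ using (ℕ; zero; suc; _∸_; _⊔_)
open import Data.Fin using (Fin; toℕ)
open import Data.Fin.Properties using () renaming (_≟_ to _≟ᶠ_)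
open import Data.Vec using (Vec; []; _∷_; lookup)
open import Data.List using (List; []; _∷_; map; filter; length; foldr; upTo; allFin; concatMap; _++_)
open import Data.Product using (Σ; ∃; ∃-syntax; _×_; _,_; proj₁; proj₂)
open import Relation.Nullary using (¬_; Dec; does)
open import Relation.Binary using (IsTotalOrder)
open import Relation.Binary.PropositionalEquality using (_≡_; _≢_)
open import Algebra.Bundles using (CommutativeRing)
open import Level using (0ℓ)

record Graph (n : ℕ) : Set where
  field
    adj    : Fin n → Fin n → Bool
    sym    : ∀ u v → adj u v ≡ adj v u
    irrefl : ∀ u → adj u u ≡ false
open Graph public

subsets : (n : ℕ) → List (Vec Bool n)
subsets zero    = [] ∷ []
subsets (suc n) = map (false ∷_) (subsets n) ++ map (true ∷_) (subsets n)

allᵇ : ∀ {A : Set} → (A → Bool) → List A → Bool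
allᵇ p = foldr (λ a b → p a ∧ b) true

size : ∀ {n} → Vec Bool n → ℕ
size []          = 0
size (false ∷ s) = size s
size (true ∷ s)  = suc (size s)

module _ {n : ℕ} (G : Graph n) where

  numEdges : ℕ
  numEdges = length (filter (λ p → T? ((toℕ (proj₁ p) ℕ.<ᵇ toℕ (proj₂ p)) ∧ adj G (proj₁ p) (proj₂ p)))
                            (concatMap (λ u → map (u ,_) (allFin n)) (allFin n)))

  isCliqueᵇ : Vec Bool n → Bool
  isCliqueᵇ s = allᵇ (λ u → allᵇ (λ v →
                  not (lookup s u ∧ lookup s v) ∨ does (u ≟ᶠ v) ∨ adj G u v)
                  (allFin n)) (allFin n)

  cliques : List (Vec Bool n)
  cliques = filter (λ s → T? (isCliqueᵇ s)) (subsets n)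

  -- c i = number of cliques of size i  (c 0 = 1: the empty clique)
  c : ℕ → ℕ
  c i = length (filter (λ s → size s ℕ.≟ i) cliques)

  ω : ℕ
  ω = foldr _⊔_ 0 (map size cliques)

  Edgeless : Set
  Edgeless = ∀ u v → adj G u v ≡ false

  EqualCompleteMultipartite : Set
  EqualCompleteMultipartite =
    ∃[ p ] ∃[ s ] Σ (Fin n → Fin p) λ f →
      (∀ u v → (adj G u v ≡ true → f u ≢ f v) × (f u ≢ f v → adj G u v ≡ true))
      × (∀ j → length (filter (λ v → f v ≟ᶠ j) (allFin n)) ≡ s)

-- The real numbers, axiomatised as a (classical) complete ordered field.
-- Any two such are isomorphic, so quantifying over all models is the
-- same as speaking about ℝ.

record CompleteOrderedField : Set₁ where
  field
    commRing : CommutativeRing 0ℓ 0ℓ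
  open CommutativeRing commRing public
  field
    _≤_         : Carrier → Carrier → Set
    isTotalOrder : IsTotalOrder _≈_ _≤_
    _≤?_        : ∀ x y → Dec (x ≤ y)
    +-mono-≤    : ∀ {x y} z → x ≤ y → (x + z) ≤ (y + z)
    *-nonneg    : ∀ {x y} → 0# ≤ x → 0# ≤ y → 0# ≤ (x * y)
    0≉1         : ¬ (0# ≈ 1#)
    inverse     : ∀ x → ¬ (x ≈ 0#) → ∃[ y ] (x * y ≈ 1#)
    lub         : (P : Carrier → Set) → ∃ P → (∃[ b ] (∀ x → P x → x ≤ b)) →
                  ∃[ s ] ((∀ x → P x → x ≤ s) × (∀ b → (∀ x → P x → x ≤ b) → s ≤ b))

module _ (R : CompleteOrderedField) where
  open CompleteOrderedField R

  fromℕ : ℕ → Carrier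
  fromℕ zero    = 0#
  fromℕ (suc m) = 1# + fromℕ m

  pow : Carrier → ℕ → Carrier
  pow x zero    = 1#
  pow x (suc m) = x * pow x m

  sumL : List Carrier → Carrier
  sumL = foldr _+_ 0#

  PC : ∀ {n} → Graph n → Carrier → Carrier
  PC G x = sumL (map (λ i → pow (- 1#) i * (fromℕ (c G i) * pow x (ω G ∸ i)))
                     (upTo (suc (ω G))))

  -- x is the largest real root of PC(G, ·), i.e. β(G) = x
  IsLargestRoot : ∀ {n} → Graph n → Carrier → Set
  IsLargestRoot G x = (PC G x ≈ 0#) × (∀ y → PC G y ≈ 0# → y ≤ x)

{-# OPTIONS --safe #-}
module Submission where

-- With t = 1/x, PC(G, x) = x^ω D(t), where D = ∑ (- t)^|S| over the cliques S of G.  If no root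
-- of PC exceeds x, then D is nonnegative at t for G and all its induced subgraphs, since the first
-- root only grows when a vertex is deleted.  So Shearer's signed measure on the sets of vertices
-- (cliques S are contained in the random set X with probability t^|S|, other sets with probability
-- 0) is a genuine probability measure.  The variance of |X| is nt - t²(n² - 2k), which vanishes
-- exactly when x = n - 2k/n.  In that case |X| is constant, and comparing E(|X| [u ∈ X]) and
-- E(|X| [u, v ∈ X]) with the probabilities shows that G is regular of degree n - x and that any two
-- adjacent vertices have n - 2x common neighbours, so every vertex is adjacent to one of them.
-- Hence nonadjacency is an equivalence relation with classes of size x.  Conversely D(t) factors as
-- ∏ (1 - t |part|) for complete multipartite graphs.

open import Defs hiding (sym; irrefl; c)
import Algebra.Properties.CommutativeMonoid.Sum as MonoidSum
import Algebra.Properties.Ring as RingProperties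
import Algebra.Properties.Semiring.Sum as Sum
import Algebra.Solver.Ring as RingSolver
open import Algebra.Solver.Ring.AlmostCommutativeRing using (fromCommutativeRing; _-Raw-AlmostCommutative⟶_)
open import Data.Bool using (Bool; true; false; _∧_; _∨_; not; T?)
import Data.Bool.Properties as Bool
open import Data.Empty using (⊥-elim)
open import Data.Fin.Base using (Fin; zero; suc; toℕ)
open import Data.Fin.Properties using (any?; suc-injective; toℕ-injective) renaming (_≟_ to _≟ᶠ_)
open import Data.Fin.Subset using (_∩_)
import Data.Fin.Subset as Subset
import Data.Fin.Subset.Properties as Subset
open import Data.Integer.Base as ℤ using (ℤ; +_; -[1+_]; _⊖_)
import Data.Integer.Properties as ℤ
open import Data.List.Base as List using (List; []; _∷_; _++_; map; filter; length; allFin; applyUpTo; concatMap)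
import Data.List.Properties as List
open import Data.List.Relation.Unary.All as All using (All; []; _∷_)
open import Data.Maybe using (just; nothing)
open import Data.Nat.Base as ℕ using (ℕ; zero; suc; _∸_; _⊔_; s≤s)
import Data.Nat.Properties as ℕ
open import Data.Product using (_×_; _,_; proj₁; proj₂; ∃-syntax)
open import Data.Sum using (_⊎_; inj₁; inj₂; [_,_]′)
open import Data.Vec.Base using (Vec; []; _∷_; lookup; tabulate; _[_]≔_)
import Data.Vec.Properties as Vec
open import Function.Base using (_∘_; id)
open import Function.Bundles using (mk⇔; _⇔_)
open import Relation.Binary using (IsEquivalence; IsTotalOrder; WeaklyDecidable) renaming (Decidable to Decidable₂)
open import Relation.Binary.PropositionalEquality as ≡ using (_≡_; _≢_)
open import Relation.Nullary using (¬_; Dec; yes; no; does)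
open import Relation.Unary using (Decidable)

-- That the variance of |X| is nonnegative is itself the inequality β ≥ n - 2k/n, so the theorem is
-- the equality case of a second moment bound. The measure calls for D ≥ 0 at t on every induced
-- subgraph because X = S has probability t^|S| times the value at t of the polynomial D of the
-- common neighbours of S. Induced subgraphs are masks `Vec Bool n` over one adjacency function. D,
-- the clique test and the measure all recurse on the first vertex, continuing with `U` and
-- `U ∩ neighbours₀ A`, so the identities between them are parallel inductions. The only analysis is
-- the existence of a first root, obtained from suprema and Lipschitz bounds on [0, 1]. This
-- interval suffices: nx is the sum of the numbers n - deg(v), each at least 1, so x ≥ 1 and t ≤ 1.

-- Adjacency functions and vertex sets as masks.

Adjacency : ℕ → Set
Adjacency n = Fin n → Fin n → Bool

Symmetric Irreflexive : ∀ {n} → Adjacency n → Set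
Symmetric A = ∀ i j → A i j ≡ A j i
Irreflexive A = ∀ i → A i i ≡ false

inner : ∀ {n} → Adjacency (suc n) → Adjacency n
inner A i j = A (suc i) (suc j)

neighbours : ∀ {n} → Adjacency n → Fin n → Vec Bool n
neighbours A v = tabulate (A v)

neighbours₀ : ∀ {n} → Adjacency (suc n) → Vec Bool n
neighbours₀ A = tabulate (A zero ∘ suc)

∩-swap : ∀ {n} (U V W : Vec Bool n) → (U ∩ V) ∩ W ≡ (U ∩ W) ∩ V
∩-swap U V W = ≡.trans (Subset.∩-assoc U V W)
  (≡.trans (≡.cong (U ∩_) (Subset.∩-comm V W)) (≡.sym (Subset.∩-assoc U W V)))

remove-∩ : ∀ {n} (U W : Vec Bool n) v → (U ∩ W) [ v ]≔ false ≡ (U [ v ]≔ false) ∩ W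
remove-∩ (_ ∷ U) (_ ∷ W) zero    = ≡.refl
remove-∩ (_ ∷ U) (_ ∷ W) (suc v) = ≡.cong (_ ∷_) (remove-∩ U W v)

remove-∩-absent : ∀ {n} (U W : Vec Bool n) v → lookup W v ≡ false → (U [ v ]≔ false) ∩ W ≡ U ∩ W
remove-∩-absent (u ∷ U) (_ ∷ W) zero    eq = ≡.cong (_∷ U ∩ W)
  (≡.sym (≡.trans (≡.cong (u ∧_) eq) (Bool.∧-zeroʳ u)))
remove-∩-absent (_ ∷ U) (_ ∷ W) (suc v) eq = ≡.cong (_ ∷_) (remove-∩-absent U W v eq)

size-remove : ∀ {n} (U : Vec Bool n) v → lookup U v ≡ true → suc (size (U [ v ]≔ false)) ≡ size U
size-remove (true ∷ U)  zero    _  = ≡.refl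
size-remove (true ∷ U)  (suc v) eq = ≡.cong suc (size-remove U v eq)
size-remove (false ∷ U) (suc v) eq = size-remove U v eq

-- Lets `U ∩ W` be reached from `U` by deleting one vertex at a time, which is how `dep-positive-∩`
-- descends to an induced subgraph.
∩-absorbs⊎missing : ∀ {n} (U W : Vec Bool n) →
  (U ∩ W ≡ U) ⊎ (∃[ v ] (lookup U v ≡ true × lookup W v ≡ false))
∩-absorbs⊎missing []          []          = inj₁ ≡.refl
∩-absorbs⊎missing (true ∷ U)  (false ∷ W) = inj₂ (zero , ≡.refl , ≡.refl)
∩-absorbs⊎missing (false ∷ U) (w ∷ W)     = [ inj₁ ∘ ≡.cong (false ∷_) , (λ (v , p) → inj₂ (suc v , p)) ]′ (∩-absorbs⊎missing U W)
∩-absorbs⊎missing (true ∷ U)  (true ∷ W)  = [ inj₁ ∘ ≡.cong (true ∷_) , (λ (v , p) → inj₂ (suc v , p)) ]′ (∩-absorbs⊎missing U W)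

lookup-∩-tabulate : ∀ {n} (U : Vec Bool n) (a : Fin n → Bool) v → lookup (U ∩ tabulate a) v ≡ lookup U v ∧ a v
lookup-∩-tabulate U a v = ≡.trans (Vec.lookup-zipWith _∧_ v U (tabulate a)) (≡.cong (lookup U v ∧_) (Vec.lookup∘tabulate a v))

subset : ∀ {n} → Vec Bool n → Vec Bool n → Bool
subset []          []      = true
subset (false ∷ S) (_ ∷ W) = subset S W
subset (true ∷ S)  (w ∷ W) = w ∧ subset S W

-- The vertices of U outside S adjacent to all of S, when S is a clique in U.
commonNeighbours : ∀ {n} → Adjacency n → Vec Bool n → Vec Bool n → Vec Bool n
commonNeighbours A []      []          = []
commonNeighbours A (b ∷ U) (false ∷ S) = (b ∧ subset S (neighbours₀ A)) ∷ commonNeighbours (inner A) U S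
commonNeighbours A (b ∷ U) (true ∷ S)  = false ∷ commonNeighbours (inner A) (U ∩ neighbours₀ A) S

commonNeighbours-∩ : ∀ {n} (A : Adjacency n) U W S →
  commonNeighbours A (U ∩ W) S ≡ commonNeighbours A U S ∩ W
commonNeighbours-∩ A []      []      []          = ≡.refl
commonNeighbours-∩ A (b ∷ U) (w ∷ W) (false ∷ S) = ≡.cong₂ _∷_
  (≡.trans (Bool.∧-assoc b w s) (≡.trans (≡.cong (b ∧_) (Bool.∧-comm w s)) (≡.sym (Bool.∧-assoc b s w))))
  (commonNeighbours-∩ (inner A) U W S)
  where s = subset S (neighbours₀ A)
commonNeighbours-∩ A (b ∷ U) (w ∷ W) (true ∷ S)  = ≡.cong (false ∷_)
  (≡.trans (≡.cong (λ V → commonNeighbours (inner A) V S) (∩-swap U W (neighbours₀ A)))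
    (commonNeighbours-∩ (inner A) (U ∩ neighbours₀ A) W S))

-- Quotients of finite sets by decidable equivalences.

-- Surjectivity matters because `EqualCompleteMultipartite` asks every index to have a fibre of the
-- common size; an empty class would violate this.
record Quotient {n : ℕ} (_~_ : Fin n → Fin n → Set) : Set where
  field
    classes    : ℕ
    class      : Fin n → Fin classes
    sound      : ∀ u v → u ~ v → class u ≡ class v
    effective  : ∀ u v → class u ≡ class v → u ~ v
    surjective : ∀ j → ∃[ v ] class v ≡ j

-- Vertex `zero` joins the class of a later vertex related to it, if there is one, and otherwise
-- opens a new class.
quotient : ∀ {n} {_~_ : Fin n → Fin n → Set} → IsEquivalence _~_ → Decidable₂ _~_ → Quotient _~_
quotient {zero} _ _ = record
  { classes = 0 ; class = λ () ; sound = λ () ; effective = λ () ; surjective = λ () }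
quotient {suc n} {_~_} ~-equiv _~?_ with any? (λ i → zero ~? suc i) | quotient {n} {λ u v → suc u ~ suc v}
  (record { refl = IsEquivalence.refl ~-equiv ; sym = IsEquivalence.sym ~-equiv ; trans = IsEquivalence.trans ~-equiv })
  (λ u v → suc u ~? suc v)
... | yes (i , 0~i) | Q = record
  { classes    = Q.classes
  ; class      = class
  ; sound      = sound
  ; effective  = effective
  ; surjective = λ j → suc (proj₁ (Q.surjective j)) , proj₂ (Q.surjective j)
  }
  where
  module Q = Quotient Q
  module ~ = IsEquivalence ~-equiv
  class : Fin (suc n) → Fin Q.classes
  class zero    = Q.class i
  class (suc v) = Q.class v
  sound : ∀ u v → u ~ v → class u ≡ class v
  sound zero    zero    _   = ≡.refl
  sound zero    (suc v) 0~v = Q.sound i v (~.trans (~.sym 0~i) 0~v)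
  sound (suc u) zero    u~0 = Q.sound u i (~.trans u~0 0~i)
  sound (suc u) (suc v) u~v = Q.sound u v u~v
  effective : ∀ u v → class u ≡ class v → u ~ v
  effective zero    zero    _  = ~.refl
  effective zero    (suc v) eq = ~.trans 0~i (Q.effective i v eq)
  effective (suc u) zero    eq = ~.trans (Q.effective u i eq) (~.sym 0~i)
  effective (suc u) (suc v) eq = Q.effective u v eq
... | no 0≁ | Q = record
  { classes    = suc Q.classes
  ; class      = class
  ; sound      = sound
  ; effective  = effective
  ; surjective = surjective
  }
  where
  module Q = Quotient Q
  module ~ = IsEquivalence ~-equiv
  class : Fin (suc n) → Fin (suc Q.classes)
  class zero    = zero
  class (suc v) = suc (Q.class v)
  sound : ∀ u v → u ~ v → class u ≡ class v
  sound zero    zero    _   = ≡.refl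
  sound zero    (suc v) 0~v = ⊥-elim (0≁ (v , 0~v))
  sound (suc u) zero    u~0 = ⊥-elim (0≁ (u , ~.sym u~0))
  sound (suc u) (suc v) u~v = ≡.cong suc (Q.sound u v u~v)
  effective : ∀ u v → class u ≡ class v → u ~ v
  effective zero    zero    _  = ~.refl
  effective (suc u) (suc v) eq = Q.effective u v (suc-injective eq)
  surjective : ∀ j → ∃[ v ] class v ≡ j
  surjective zero    = zero , ≡.refl
  surjective (suc j) = suc (proj₁ (Q.surjective j)) , ≡.cong suc (proj₂ (Q.surjective j))

-- Recursive and pairwise descriptions of cliques.

∧-true : ∀ {a b} → a ∧ b ≡ true → a ≡ true × b ≡ true
∧-true {true} {true} _ = ≡.refl , ≡.refl

-- Follows the recursion of `dep`, so that `dep-sum` is a direct induction; `CliqueIn` is the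
-- intermediate form linking it to `isCliqueᵇ`.
isClique : ∀ {n} → Adjacency n → Vec Bool n → Vec Bool n → Bool
isClique A []      []          = true
isClique A (b ∷ U) (false ∷ S) = isClique (inner A) U S
isClique A (b ∷ U) (true ∷ S)  = b ∧ isClique (inner A) (U ∩ neighbours₀ A) S

CliqueIn : ∀ {n} → Adjacency n → Vec Bool n → Vec Bool n → Set
CliqueIn A U S = (∀ u → lookup S u ≡ true → lookup U u ≡ true) ×
  (∀ u v → lookup S u ≡ true → lookup S v ≡ true → u ≢ v → A u v ≡ true)

isClique-sound : ∀ {n} (A : Adjacency n) → Symmetric A → ∀ U S → isClique A U S ≡ true → CliqueIn A U S
isClique-sound A A-sym []      []          _  = (λ ()) , (λ ())
isClique-sound A A-sym (b ∷ U) (false ∷ S) eq with isClique-sound (inner A) (λ i j → A-sym (suc i) (suc j)) U S eq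
... | (S⊆U , adjacent) = ⊆ , adj′
  where
  ⊆ : ∀ u → lookup (false ∷ S) u ≡ true → lookup (b ∷ U) u ≡ true
  ⊆ (suc u) = S⊆U u
  adj′ : ∀ u v → lookup (false ∷ S) u ≡ true → lookup (false ∷ S) v ≡ true → u ≢ v → A u v ≡ true
  adj′ (suc u) (suc v) u∈S v∈S u≢v = adjacent u v u∈S v∈S (u≢v ∘ ≡.cong suc)
isClique-sound A A-sym (b ∷ U) (true ∷ S)  eq with ∧-true {b} eq
... | (b≡true , eq′) with isClique-sound (inner A) (λ i j → A-sym (suc i) (suc j)) (U ∩ neighbours₀ A) S eq′
... | (S⊆UN , adjacent) = ⊆ , adj′
  where
  split : ∀ u → lookup S u ≡ true → lookup U u ≡ true × A zero (suc u) ≡ true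
  split u u∈S = ∧-true (≡.trans (≡.sym (lookup-∩-tabulate U _ u)) (S⊆UN u u∈S))
  ⊆ : ∀ u → lookup (true ∷ S) u ≡ true → lookup (b ∷ U) u ≡ true
  ⊆ zero    _   = b≡true
  ⊆ (suc u) u∈S = proj₁ (split u u∈S)
  adj′ : ∀ u v → lookup (true ∷ S) u ≡ true → lookup (true ∷ S) v ≡ true → u ≢ v → A u v ≡ true
  adj′ zero    zero    _   _   0≢0 = ⊥-elim (0≢0 ≡.refl)
  adj′ zero    (suc v) _   v∈S _   = proj₂ (split v v∈S)
  adj′ (suc u) zero    u∈S _   _   = ≡.trans (A-sym (suc u) zero) (proj₂ (split u u∈S))
  adj′ (suc u) (suc v) u∈S v∈S u≢v = adjacent u v u∈S v∈S (u≢v ∘ ≡.cong suc)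

isClique-complete : ∀ {n} (A : Adjacency n) U S → CliqueIn A U S → isClique A U S ≡ true
isClique-complete A []      []          _ = ≡.refl
isClique-complete A (b ∷ U) (false ∷ S) (S⊆U , adjacent) = isClique-complete (inner A) U S
  (S⊆U ∘ suc , λ u v u∈S v∈S u≢v → adjacent (suc u) (suc v) u∈S v∈S (u≢v ∘ suc-injective))
isClique-complete A (b ∷ U) (true ∷ S)  (S⊆U , adjacent) = ≡.cong₂ _∧_ (S⊆U zero ≡.refl)
  (isClique-complete (inner A) (U ∩ neighbours₀ A) S
    ((λ u u∈S → ≡.trans (lookup-∩-tabulate U _ u) (≡.cong₂ _∧_ (S⊆U (suc u) u∈S) (adjacent zero (suc u) ≡.refl u∈S (λ ())))) ,
     λ u v u∈S v∈S u≢v → adjacent (suc u) (suc v) u∈S v∈S (u≢v ∘ suc-injective)))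

module _ {A : Set} (p : A → Bool) where
  allᵇ-tabulate⁻ : ∀ {n} (g : Fin n → A) → allᵇ p (List.tabulate g) ≡ true → ∀ i → p (g i) ≡ true
  allᵇ-tabulate⁻ g eq zero    = proj₁ (∧-true eq)
  allᵇ-tabulate⁻ g eq (suc i) = allᵇ-tabulate⁻ (g ∘ suc) (proj₂ (∧-true {p (g zero)} eq)) i

  allᵇ-tabulate⁺ : ∀ {n} (g : Fin n → A) → (∀ i → p (g i) ≡ true) → allᵇ p (List.tabulate g) ≡ true
  allᵇ-tabulate⁺ {zero}  g pg = ≡.refl
  allᵇ-tabulate⁺ {suc n} g pg = ≡.cong₂ _∧_ (pg zero) (allᵇ-tabulate⁺ (g ∘ suc) (pg ∘ suc))

module _ {n} (G : Graph n) where

  isClique≡isCliqueᵇ : ∀ S → isClique (adj G) Subset.⊤ S ≡ isCliqueᵇ G S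
  isClique≡isCliqueᵇ S = Bool.⇔→≡ {z = true} (mk⇔ to from)
    where
    pair : Fin n → Fin n → Bool
    pair u v = not (lookup S u ∧ lookup S v) ∨ does (u ≟ᶠ v) ∨ adj G u v

    pair⁺ : (∀ u v → lookup S u ≡ true → lookup S v ≡ true → u ≢ v → adj G u v ≡ true) → ∀ u v → pair u v ≡ true
    pair⁺ adjacent u v with lookup S u in u∈S | lookup S v in v∈S | u ≟ᶠ v
    ... | false | _     | _       = ≡.refl
    ... | true  | false | _       = ≡.refl
    ... | true  | true  | yes _   = ≡.refl
    ... | true  | true  | no  u≢v = adjacent u v u∈S v∈S u≢v

    pair⁻ : ∀ u v → pair u v ≡ true → lookup S u ≡ true → lookup S v ≡ true → u ≢ v → adj G u v ≡ true
    pair⁻ u v eq u∈S v∈S u≢v with lookup S u | lookup S v | u ≟ᶠ v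
    ... | true | true | yes u≡v = ⊥-elim (u≢v u≡v)
    ... | true | true | no  _   = eq

    to : isClique (adj G) Subset.⊤ S ≡ true → isCliqueᵇ G S ≡ true
    to eq = allᵇ-tabulate⁺ _ id (λ u → allᵇ-tabulate⁺ (pair u) id
      (pair⁺ (proj₂ (isClique-sound (adj G) (Graph.sym G) Subset.⊤ S eq)) u))

    from : isCliqueᵇ G S ≡ true → isClique (adj G) Subset.⊤ S ≡ true
    from eq = isClique-complete (adj G) Subset.⊤ S
      ((λ u _ → Vec.lookup-replicate u true) ,
       λ u v → pair⁻ u v (allᵇ-tabulate⁻ (pair u) id (allᵇ-tabulate⁻ (λ u → allᵇ (pair u) (allFin n)) id eq u) v))

  -- With this bound the truncated `ω G ∸ i` in `PC` is a true subtraction at every clique size.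
  size≤ω : All (λ S → size S ℕ.≤ ω G) (cliques G)
  size≤ω = below-max (cliques G)
    where
    below-max : ∀ L → All (λ S → size S ℕ.≤ List.foldr _⊔_ 0 (map size L)) L
    below-max []      = []
    below-max (S ∷ L) = ℕ.m≤m⊔n (size S) _ ∷ All.map (λ ≤max → ℕ.≤-trans ≤max (ℕ.m≤n⊔m (size S) _)) (below-max L)

-- All vertices form a single part, so the first alternative of the theorem is an instance of the
-- second.
edgeless⇒multipartite : ∀ {n} (G : Graph n) → Edgeless G → EqualCompleteMultipartite G
edgeless⇒multipartite {n} G edgeless = 1 , n , (λ _ → zero) ,
  (λ u v → (λ uv → ⊥-elim (Bool.not-¬ (edgeless u v) uv)) , λ 0≢0 → ⊥-elim (0≢0 ≡.refl)) ,
  λ { zero → ≡.trans (≡.cong length (List.filter-all (λ _ → zero ≟ᶠ zero) (All.universal (λ _ → ≡.refl) (allFin n)))) (List.length-tabulate id) }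

-- Arithmetic and order in a complete ordered field.

module OrderedField (R : CompleteOrderedField) where

  open CompleteOrderedField R public hiding (zero)
    renaming (_≤_ to infix 4 _≤_; _≤?_ to infix 4 _≤?_)
  open RingProperties ring public using (-0#≈0#; -‿involutive; -‿distribˡ-*; -‿distribʳ-*)
  open IsTotalOrder isTotalOrder public using (antisym; total)
    renaming (refl to ≤-refl; trans to ≤-trans; reflexive to ≤-reflexive; ≤-respˡ-≈ to ≤-respˡ; ≤-respʳ-≈ to ≤-respʳ)
  open import Relation.Binary.Reasoning.Setoid setoid public

  nat : ℕ → Carrier
  nat = fromℕ R

  nat-+ : ∀ m n → nat (m ℕ.+ n) ≈ nat m + nat n
  nat-+ zero    n = sym (+-identityˡ _)
  nat-+ (suc m) n = trans (+-congˡ (nat-+ m n)) (sym (+-assoc _ _ _))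

  nat-* : ∀ m n → nat (m ℕ.* n) ≈ nat m * nat n
  nat-* zero    n = sym (zeroˡ _)
  nat-* (suc m) n = begin
    nat (n ℕ.+ m ℕ.* n)      ≈⟨ nat-+ n (m ℕ.* n) ⟩
    nat n + nat (m ℕ.* n)    ≈⟨ +-cong (sym (*-identityˡ _)) (nat-* m n) ⟩
    1# * nat n + nat m * nat n ≈⟨ distribʳ _ _ _ ⟨
    (1# + nat m) * nat n     ∎

  int : ℤ → Carrier
  int (+ n)    = nat n
  int -[1+ n ] = - nat (suc n)

  private
    cancel-suc : ∀ a b → (1# + a) - (1# + b) ≈ a - b
    cancel-suc a b = begin
      (1# + a) - (1# + b)       ≈⟨ +-cong (+-comm 1# a) (sym (-‿+-comm 1# b)) ⟩
      (a + 1#) + (- 1# + - b)   ≈⟨ +-assoc a 1# _ ⟩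
      a + (1# + (- 1# + - b))   ≈⟨ +-congˡ (+-assoc 1# _ _) ⟨
      a + ((1# + - 1#) + - b)   ≈⟨ +-congˡ (+-congʳ (-‿inverseʳ 1#)) ⟩
      a + (0# + - b)            ≈⟨ +-congˡ (+-identityˡ _) ⟩
      a - b                     ∎
      where open RingProperties ring using (-‿+-comm)

  int-⊖ : ∀ m n → int (m ⊖ n) ≈ nat m - nat n
  int-⊖ zero    zero    = sym (-‿inverseʳ 0#)
  int-⊖ zero    (suc n) = sym (+-identityˡ _)
  int-⊖ (suc m) zero    = sym (trans (+-congˡ -0#≈0#) (+-identityʳ _))
  int-⊖ (suc m) (suc n) = begin
    int (suc m ⊖ suc n)          ≡⟨ ≡.cong int (ℤ.[1+m]⊖[1+n]≡m⊖n m n) ⟩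
    int (m ⊖ n)                  ≈⟨ int-⊖ m n ⟩
    nat m - nat n                ≈⟨ cancel-suc _ _ ⟨
    nat (suc m) - nat (suc n)    ∎

  int-+ : ∀ i j → int (i ℤ.+ j) ≈ int i + int j
  int-+ (+ m)    (+ n)    = nat-+ m n
  int-+ (+ m)    -[1+ n ] = int-⊖ m (suc n)
  int-+ -[1+ m ] (+ n)    = trans (int-⊖ n (suc m)) (+-comm _ _)
  int-+ -[1+ m ] -[1+ n ] = begin
    - nat (suc (suc (m ℕ.+ n)))       ≡⟨ ≡.cong (λ k → - nat (suc k)) (ℕ.+-suc m n) ⟨
    - nat (suc m ℕ.+ suc n)           ≈⟨ -‿cong (nat-+ (suc m) (suc n)) ⟩
    - (nat (suc m) + nat (suc n))     ≈⟨ -‿+-comm _ _ ⟨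
    - nat (suc m) - nat (suc n)       ∎
    where open RingProperties ring using (-‿+-comm)

  int-neg : ∀ i → int (ℤ.- i) ≈ - int i
  int-neg (+ zero)  = sym -0#≈0#
  int-neg (+ suc n) = refl
  int-neg -[1+ n ]  = sym (-‿involutive _)

  private
    int-*-pos : ∀ m j → int (+ m ℤ.* j) ≈ nat m * int j
    int-*-pos m (+ n) = trans (reflexive (≡.cong int (≡.sym (ℤ.pos-* m n)))) (nat-* m n)
    int-*-pos m -[1+ n ] = begin
      int (+ m ℤ.* -[1+ n ])          ≡⟨ ≡.cong int (ℤ.neg-distribʳ-* (+ m) (+ suc n)) ⟨
      int (ℤ.- (+ m ℤ.* + suc n))     ≈⟨ int-neg (+ m ℤ.* + suc n) ⟩
      - int (+ m ℤ.* + suc n)         ≈⟨ -‿cong (int-*-pos m (+ suc n)) ⟩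
      - (nat m * nat (suc n))         ≈⟨ -‿distribʳ-* _ _ ⟩
      nat m * - nat (suc n)           ∎

  int-* : ∀ i j → int (i ℤ.* j) ≈ int i * int j
  int-* (+ m)    j = int-*-pos m j
  int-* -[1+ m ] j = begin
    int (-[1+ m ] ℤ.* j)            ≡⟨ ≡.cong int (ℤ.neg-distribˡ-* (+ suc m) j) ⟨
    int (ℤ.- (+ suc m ℤ.* j))       ≈⟨ int-neg (+ suc m ℤ.* j) ⟩
    - int (+ suc m ℤ.* j)           ≈⟨ -‿cong (int-*-pos (suc m) j) ⟩
    - (nat (suc m) * int j)         ≈⟨ -‿distribˡ-* _ _ ⟩
    - nat (suc m) * int j           ∎

  -- int (+ 1) is 1# + 0#; the solver constant should be 1# on the nose.
  coeff : ℤ → Carrier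
  coeff (+ 1) = 1#
  coeff i     = int i

  coeff≈int : ∀ i → coeff i ≈ int i
  coeff≈int (+ zero)        = refl
  coeff≈int (+ suc zero)    = sym (+-identityʳ 1#)
  coeff≈int (+ suc (suc n)) = refl
  coeff≈int -[1+ n ]        = refl

  private
    ℤ-morphism : ℤ.+-*-rawRing -Raw-AlmostCommutative⟶ fromCommutativeRing commRing
    ℤ-morphism = record
      { ⟦_⟧    = coeff
      ; +-homo = λ i j → trans (coeff≈int (i ℤ.+ j))
                   (trans (int-+ i j) (+-cong (sym (coeff≈int i)) (sym (coeff≈int j))))
      ; *-homo = λ i j → trans (coeff≈int (i ℤ.* j))
                   (trans (int-* i j) (*-cong (sym (coeff≈int i)) (sym (coeff≈int j))))
      ; -‿homo = λ i → trans (coeff≈int (ℤ.- i)) (trans (int-neg i) (-‿cong (sym (coeff≈int i))))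
      ; 0-homo = refl
      ; 1-homo = refl
      }

    coeff-≟ : WeaklyDecidable (λ i j → coeff i ≈ coeff j)
    coeff-≟ i j with i ℤ.≟ j
    ... | yes i≡j = just (reflexive (≡.cong coeff i≡j))
    ... | no  _   = nothing

  open RingSolver ℤ.+-*-rawRing (fromCommutativeRing commRing) ℤ-morphism coeff-≟ public
    using (Polynomial; solve; _:=_; _:+_; _:*_; _:-_; :-_; con)

  :0 :1 : ∀ {n} → Polynomial n
  :0 = con (+ 0)
  :1 = con (+ 1)

  infix 4 _<_
  _<_ : Carrier → Carrier → Set
  a < b = ¬ (b ≤ a)

  <⇒≤ : ∀ {a b} → a < b → a ≤ b
  <⇒≤ {a} {b} a<b = [ (λ a≤b → a≤b) , (λ b≤a → ⊥-elim (a<b b≤a)) ]′ (total a b)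

  ≤⊎> : ∀ a b → a ≤ b ⊎ b < a
  ≤⊎> a b with a ≤? b
  ... | yes a≤b = inj₁ a≤b
  ... | no  b<a = inj₂ b<a

  ≤-<-trans : ∀ {a b c} → a ≤ b → b < c → a < c
  ≤-<-trans a≤b b<c c≤a = b<c (≤-trans c≤a a≤b)

  <-≤-trans : ∀ {a b c} → a < b → b ≤ c → a < c
  <-≤-trans a<b b≤c c≤a = a<b (≤-trans b≤c c≤a)

  infix 4 _≈?_
  -- The field decides only `_≤_`; antisymmetry turns two comparisons into a decision of equality.
  -- The case splits before `integral` rest on it.
  _≈?_ : ∀ a b → Dec (a ≈ b)
  a ≈? b with a ≤? b | b ≤? a
  ... | yes a≤b | yes b≤a = yes (antisym a≤b b≤a)
  ... | no  a≰b | _       = no (λ a≈b → a≰b (≤-reflexive a≈b))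
  ... | yes _   | no  b≰a = no (λ a≈b → b≰a (≤-reflexive (sym a≈b)))

  abstract
    diff-nonneg : ∀ {a b} → a ≤ b → 0# ≤ b - a
    diff-nonneg {a} a≤b = ≤-respˡ (-‿inverseʳ a) (+-mono-≤ (- a) a≤b)

    -- Most inequalities below are proved by exhibiting the difference as a visibly nonnegative expression.
    ≤-by : ∀ {a b e} → 0# ≤ e → e ≈ b - a → a ≤ b
    ≤-by {a} {b} {e} 0≤e e≈ = ≤-respˡ (+-identityˡ a)
      (≤-respʳ (trans (+-congʳ e≈) (solve 2 (λ b a → b :- a :+ a := b) refl b a)) (+-mono-≤ a 0≤e))

    +-nonneg : ∀ {a b} → 0# ≤ a → 0# ≤ b → 0# ≤ a + b
    +-nonneg {a} {b} 0≤a 0≤b = ≤-trans 0≤b (≤-respˡ (+-identityˡ b) (+-mono-≤ b 0≤a))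

    +-mono : ∀ {a b c d} → a ≤ b → c ≤ d → a + c ≤ b + d
    +-mono {a} {b} {c} {d} a≤b c≤d = ≤-by (+-nonneg (diff-nonneg a≤b) (diff-nonneg c≤d))
      (solve 4 (λ a b c d → b :- a :+ (d :- c) := b :+ d :- (a :+ c)) refl a b c d)

    *-monoˡ : ∀ {a b c} → 0# ≤ c → a ≤ b → c * a ≤ c * b
    *-monoˡ {a} {b} {c} 0≤c a≤b = ≤-by (*-nonneg 0≤c (diff-nonneg a≤b))
      (solve 3 (λ a b c → c :* (b :- a) := c :* b :- c :* a) refl a b c)

    neg-nonneg : ∀ {a} → a ≤ 0# → 0# ≤ - a
    neg-nonneg {a} a≤0 = ≤-respʳ (+-identityˡ _) (diff-nonneg a≤0)

    square-nonneg : ∀ a → 0# ≤ a * a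
    square-nonneg a with total 0# a
    ... | inj₁ 0≤a = *-nonneg 0≤a 0≤a
    ... | inj₂ a≤0 = ≤-respʳ (solve 1 (λ a → :- a :* :- a := a :* a) refl a)
      (*-nonneg (neg-nonneg a≤0) (neg-nonneg a≤0))

    0≤1 : 0# ≤ 1#
    0≤1 = ≤-respʳ (*-identityˡ 1#) (square-nonneg 1#)

    0<1 : 0# < 1#
    0<1 1≤0 = 0≉1 (antisym 0≤1 1≤0)

    nat-nonneg : ∀ n → 0# ≤ nat n
    nat-nonneg zero    = ≤-refl
    nat-nonneg (suc n) = +-nonneg 0≤1 (nat-nonneg n)

    <+1 : ∀ a → a < a + 1#
    <+1 a a+1≤a = 0<1 (≤-by (diff-nonneg a+1≤a) (solve 1 (λ a → a :- (a :+ :1) := :0 :- :1) refl a))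

    0<nat-suc : ∀ n → 0# < nat (suc n)
    0<nat-suc n = ≤-<-trans (nat-nonneg n) (λ 1+n≤n → <+1 (nat n) (≤-respˡ (+-comm 1# _) 1+n≤n))

    -- An ordered field has characteristic zero. This carries equality of class sizes from the field
    -- back to `ℕ`.
    nat-injective : ∀ {m n} → nat m ≈ nat n → m ≡ n
    nat-injective {zero}  {zero}  _ = ≡.refl
    nat-injective {zero}  {suc n} e = ⊥-elim (0<nat-suc n (≤-reflexive (sym e)))
    nat-injective {suc m} {zero}  e = ⊥-elim (0<nat-suc m (≤-reflexive e))
    nat-injective {suc m} {suc n} e = ≡.cong suc (nat-injective (begin
      nat m               ≈⟨ solve 1 (λ a → a := :1 :+ a :- :1) refl (nat m) ⟩
      1# + nat m - 1#     ≈⟨ +-congʳ e ⟩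
      1# + nat n - 1#     ≈⟨ solve 1 (λ a → :1 :+ a :- :1 := a) refl (nat n) ⟩
      nat n               ∎))

    <⇒≉ : ∀ {a} → 0# < a → ¬ (a ≈ 0#)
    <⇒≉ 0<a a≈0 = 0<a (≤-reflexive a≈0)

    integral : ∀ {a b} → a * b ≈ 0# → ¬ (a ≈ 0#) → b ≈ 0#
    integral {a} {b} ab≈0 a≉0 with inverse a a≉0
    ... | (a⁻¹ , aa⁻¹≈1) = begin
      b               ≈⟨ *-identityˡ b ⟨
      1# * b          ≈⟨ *-congʳ aa⁻¹≈1 ⟨
      a * a⁻¹ * b     ≈⟨ solve 3 (λ a i b → a :* i :* b := i :* (a :* b)) refl a a⁻¹ b ⟩
      a⁻¹ * (a * b)   ≈⟨ *-congˡ ab≈0 ⟩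
      a⁻¹ * 0#        ≈⟨ zeroʳ a⁻¹ ⟩
      0#              ∎

    *-pos : ∀ {a b} → 0# < a → 0# < b → 0# < a * b
    *-pos {a} {b} 0<a 0<b ab≤0 = <⇒≉ 0<b
      (integral (antisym ab≤0 (*-nonneg (<⇒≤ 0<a) (<⇒≤ 0<b))) (<⇒≉ 0<a))

    cancelˡ : ∀ {a b c} → 0# < a → a * b ≈ a * c → b ≈ c
    cancelˡ {a} {b} {c} 0<a ab≈ac = begin
      b             ≈⟨ solve 2 (λ b c → b := b :- c :+ c) refl b c ⟩
      b - c + c     ≈⟨ +-congʳ (integral (begin
        a * (b - c)     ≈⟨ solve 3 (λ a b c → a :* (b :- c) := a :* b :- a :* c) refl a b c ⟩
        a * b - a * c   ≈⟨ +-congʳ ab≈ac ⟩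
        a * c - a * c   ≈⟨ -‿inverseʳ _ ⟩
        0#              ∎) (<⇒≉ 0<a)) ⟩
      0# + c        ≈⟨ +-identityˡ c ⟩
      c             ∎

    cancelˡ-≤ : ∀ {a b c} → 0# < a → a * b ≤ a * c → b ≤ c
    cancelˡ-≤ {a} {b} {c} 0<a ab≤ac with ≤⊎> b c
    ... | inj₁ b≤c = b≤c
    ... | inj₂ c<b = ⊥-elim (c<b (≤-reflexive
      (cancelˡ 0<a (antisym ab≤ac (*-monoˡ (<⇒≤ 0<a) (<⇒≤ c<b))))))

    pos-factor : ∀ {a b} → 0# < a → 0# < a * b → 0# < b
    pos-factor {a} 0<a 0<ab b≤0 = 0<ab (≤-respʳ (zeroʳ a) (*-monoˡ (<⇒≤ 0<a) b≤0))

module CliquePolynomial (R : CompleteOrderedField) where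

  open OrderedField R

  -- Lipschitz functions and first roots

  -- The bound |d| ≤ e, written without an absolute value so that everything reduces to `+-nonneg`
  -- and `*-nonneg`.
  Within : Carrier → Carrier → Set
  Within d e = (0# ≤ e + d) × (0# ≤ e - d)

  within-cong : ∀ {d d′ e e′} → d ≈ d′ → e ≈ e′ → Within d e → Within d′ e′
  within-cong d≈ e≈ (p , q) = ≤-respʳ (+-cong e≈ d≈) p , ≤-respʳ (+-cong e≈ (-‿cong d≈)) q

  abstract
    within-minus : ∀ {d d′ e e′} → Within d e → Within d′ e′ → Within (d - d′) (e + e′)
    within-minus {d} {d′} {e} {e′} (p , q) (p′ , q′) =
      ≤-respʳ (solve 4 (λ d d′ e e′ → e :+ d :+ (e′ :- d′) := e :+ e′ :+ (d :- d′)) refl d d′ e e′) (+-nonneg p q′) ,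
      ≤-respʳ (solve 4 (λ d d′ e e′ → e :- d :+ (e′ :+ d′) := e :+ e′ :- (d :- d′)) refl d d′ e e′) (+-nonneg q p′)

    within-+ : ∀ {d d′ e e′} → Within d e → Within d′ e′ → Within (d + d′) (e + e′)
    within-+ {d} {d′} {e} {e′} (p , q) (p′ , q′) =
      ≤-respʳ (solve 4 (λ d d′ e e′ → e :+ d :+ (e′ :+ d′) := e :+ e′ :+ (d :+ d′)) refl d d′ e e′) (+-nonneg p p′) ,
      ≤-respʳ (solve 4 (λ d d′ e e′ → e :- d :+ (e′ :- d′) := e :+ e′ :- (d :+ d′)) refl d d′ e e′) (+-nonneg q q′)

    within-* : ∀ {c d e} → 0# ≤ c → Within d e → Within (c * d) (c * e)
    within-* {c} {d} {e} 0≤c (p , q) =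
      ≤-respʳ (solve 3 (λ c d e → c :* (e :+ d) := c :* e :+ c :* d) refl c d e) (*-nonneg 0≤c p) ,
      ≤-respʳ (solve 3 (λ c d e → c :* (e :- d) := c :* e :- c :* d) refl c d e) (*-nonneg 0≤c q)

    within-mono : ∀ {d e e′} → e ≤ e′ → Within d e → Within d e′
    within-mono e≤e′ (p , q) = ≤-trans p (+-mono-≤ _ e≤e′) , ≤-trans q (+-mono-≤ _ e≤e′)

    within-shrink : ∀ {k d e} → 0# ≤ k → k ≤ 1# → 0# ≤ e → Within d e → Within (k * d) e
    within-shrink {k} {d} {e} 0≤k k≤1 0≤e w = within-mono
      (≤-by (*-nonneg (diff-nonneg k≤1) 0≤e) (solve 2 (λ k e → (:1 :- k) :* e := e :- k :* e) refl k e))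
      (within-* 0≤k w)

    *-≤1 : ∀ {a b} → 0# ≤ a → a ≤ 1# → b ≤ 1# → a * b ≤ 1#
    *-≤1 {a} {b} 0≤a a≤1 b≤1 = ≤-trans (*-monoˡ 0≤a b≤1) (≤-respˡ (sym (*-identityʳ a)) a≤1)

  -- Stands in for continuity. On [0, 1] the recursion of `dep` multiplies only by factors in
  -- [0, 1], so the bounds of the two branches simply add up.
  record Lipschitz (f : Carrier → Carrier) : Set where
    field
      bound slope     : Carrier
      0≤bound         : 0# ≤ bound
      0≤slope         : 0# ≤ slope
      bounded         : ∀ s → 0# ≤ s → s ≤ 1# → Within (f s) bound
      slope-bounded   : ∀ r s → 0# ≤ r → r ≤ s → s ≤ 1# → Within (f s - f r) (slope * (s - r))

  abstract
    lipschitz-1 : Lipschitz (λ _ → 1#)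
    lipschitz-1 = record
      { bound         = 1#
      ; slope         = 0#
      ; 0≤bound       = 0≤1
      ; 0≤slope       = ≤-refl
      ; bounded       = λ _ _ _ → +-nonneg 0≤1 0≤1 , ≤-reflexive (sym (-‿inverseʳ 1#))
      ; slope-bounded = λ r s _ _ _ →
          ≤-reflexive (solve 2 (λ s r → :0 := :0 :* (s :- r) :+ (:1 :- :1)) refl s r) ,
          ≤-reflexive (solve 2 (λ s r → :0 := :0 :* (s :- r) :- (:1 :- :1)) refl s r)
      }

    -- The shape `f s - k * s * g s` is the recursive clause of `dep`, with `k` the indicator of the
    -- first vertex.
    lipschitz-step : ∀ {f g k} → 0# ≤ k → k ≤ 1# → Lipschitz f → Lipschitz g →
                     Lipschitz (λ s → f s - k * s * g s)
    lipschitz-step {f} {g} {k} 0≤k k≤1 F G = record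
      { bound         = F.bound + G.bound
      ; slope         = F.slope + (G.slope + G.bound)
      ; 0≤bound       = +-nonneg F.0≤bound G.0≤bound
      ; 0≤slope       = +-nonneg F.0≤slope (+-nonneg G.0≤slope G.0≤bound)
      ; bounded       = λ s 0≤s s≤1 → within-minus (F.bounded s 0≤s s≤1)
          (within-shrink (*-nonneg 0≤k 0≤s) (*-≤1 0≤k k≤1 s≤1) G.0≤bound (G.bounded s 0≤s s≤1))
      ; slope-bounded = λ r s 0≤r r≤s s≤1 →
          let 0≤s   = ≤-trans 0≤r r≤s
              0≤s-r = diff-nonneg r≤s
              -- Product rule: s g(s) - r g(r) = s (g(s) - g(r)) + (s - r) g(r). The slope of `g`
              -- bounds the first term, its size bounds the second.
              sΔg   = within-shrink 0≤s s≤1 (*-nonneg G.0≤slope 0≤s-r) (G.slope-bounded r s 0≤r r≤s s≤1)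
              Δs·g  = within-* 0≤s-r (G.bounded r 0≤r (≤-trans r≤s s≤1))
              kΔsg  = within-shrink 0≤k k≤1
                        (+-nonneg (*-nonneg G.0≤slope 0≤s-r) (*-nonneg 0≤s-r G.0≤bound))
                        (within-+ sΔg Δs·g)
          in within-cong
               (solve 7 (λ s r k fs fr gs gr →
                  fs :- fr :- k :* (s :* (gs :- gr) :+ (s :- r) :* gr)
                  := fs :- k :* s :* gs :- (fr :- k :* r :* gr)) refl s r k (f s) (f r) (g s) (g r))
               (solve 5 (λ s r l m b → l :* (s :- r) :+ (m :* (s :- r) :+ (s :- r) :* b)
                  := (l :+ (m :+ b)) :* (s :- r)) refl s r F.slope G.slope G.bound)
               (within-minus (F.slope-bounded r s 0≤r r≤s s≤1) kΔsg)
      }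
      where
      module F = Lipschitz F
      module G = Lipschitz G

  PositiveBelow : (Carrier → Carrier) → Carrier → Set
  PositiveBelow f a = ∀ r → 0# ≤ r → r < a → 0# < f r

  module _ {f : Carrier → Carrier} (F : Lipschitz f) where
    open Lipschitz F

    abstract
      0<slope+1 : 0# < slope + 1#
      0<slope+1 = ≤-<-trans 0≤slope (<+1 slope)

      -- A function of value v at s keeps its sign on the interval of radius |v| / (slope + 1) around s.
      radius : ∀ {v} → 0# < v → ∃[ δ ] (0# < δ × slope * δ ≈ v - δ)
      radius {v} 0<v with inverse (slope + 1#) (<⇒≉ 0<slope+1)
      ... | (i , Li≈1) = i * v , pos-factor 0<slope+1 (λ p → 0<v (≤-respˡ Lδ≈v p)) ,
        (begin
          slope * (i * v)                            ≈⟨ solve 2 (λ l d → l :* d := (l :+ :1) :* d :- d) refl slope (i * v) ⟩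
          (slope + 1#) * (i * v) - i * v             ≈⟨ +-congʳ Lδ≈v ⟩
          v - i * v                                  ∎)
        where
        Lδ≈v : (slope + 1#) * (i * v) ≈ v
        Lδ≈v = trans (sym (*-assoc _ i v)) (trans (*-congʳ Li≈1) (*-identityˡ v))

      positive-right : ∀ s → 0# ≤ s → 0# < f s →
        ∃[ δ ] (0# < δ × (∀ r → s ≤ r → r ≤ s + δ → r ≤ 1# → 0# < f r))
      positive-right s 0≤s 0<fs with radius 0<fs
      ... | (δ , 0<δ , Lδ≈) = δ , 0<δ , λ r s≤r r≤s+δ r≤1 → <-≤-trans 0<δ
        (≤-by (+-nonneg (proj₁ (slope-bounded s r 0≤s s≤r r≤1)) (*-nonneg 0≤slope (diff-nonneg r≤s+δ)))
          (begin
            slope * (r - s) + (f r - f s) + slope * (s + δ - r)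
              ≈⟨ solve 6 (λ l r s δ a b → l :* (r :- s) :+ (a :- b) :+ l :* (s :+ δ :- r) := l :* δ :+ (a :- b)) refl slope r s δ (f r) (f s) ⟩
            slope * δ + (f r - f s)
              ≈⟨ +-congʳ Lδ≈ ⟩
            f s - δ + (f r - f s)
              ≈⟨ solve 3 (λ a b δ → b :- δ :+ (a :- b) := a :- δ) refl (f r) (f s) δ ⟩
            f r - δ ∎))

      negative-left : ∀ s → s ≤ 1# → f s < 0# →
        ∃[ δ ] (0# < δ × (∀ r → 0# ≤ r → r ≤ s → s - δ ≤ r → f r < 0#))
      negative-left s s≤1 fs<0 with radius {0# - f s} (λ p → fs<0 (≤-by (neg-nonneg p) (solve 1 (λ a → :- (:0 :- a) := a :- :0) refl (f s))))
      ... | (δ , 0<δ , Lδ≈) = δ , 0<δ , λ r 0≤r r≤s s-δ≤r 0≤fr → 0<δ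
        (≤-by (+-nonneg (+-nonneg (proj₁ (slope-bounded r s 0≤r r≤s s≤1)) (*-nonneg 0≤slope (diff-nonneg s-δ≤r))) 0≤fr)
          (begin
            slope * (s - r) + (f s - f r) + slope * (r - (s - δ)) + f r
              ≈⟨ solve 6 (λ l r s δ a b → l :* (s :- r) :+ (b :- a) :+ l :* (r :- (s :- δ)) :+ a := l :* δ :+ b) refl slope r s δ (f r) (f s) ⟩
            slope * δ + f s
              ≈⟨ +-congʳ Lδ≈ ⟩
            0# - f s - δ + f s
              ≈⟨ solve 2 (λ b δ → :0 :- b :- δ :+ b := :0 :- δ) refl (f s) δ ⟩
            0# - δ ∎))

    -- Were `f s` negative, `f` would be negative on a stretch to the left of `s`, against
    -- positivity there. If that stretch reaches past 0, the value at 0 gives the contradiction.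
    nonneg-closure : 0# < f 0# → ∀ {s} → 0# ≤ s → s ≤ 1# → PositiveBelow f s → 0# ≤ f s
    nonneg-closure 0<f0 {s} 0≤s s≤1 pos with ≤⊎> 0# (f s)
    ... | inj₁ 0≤fs = 0≤fs
    ... | inj₂ fs<0 with negative-left s s≤1 fs<0
    ... | (δ , 0<δ , neg) with ≤⊎> 0# (s - δ)
    ... | inj₁ 0≤s-δ = ⊥-elim (neg (s - δ) 0≤s-δ
              (≤-by (<⇒≤ 0<δ) (solve 2 (λ s δ → δ := s :- (s :- δ)) refl s δ)) ≤-refl
              (<⇒≤ (pos (s - δ) 0≤s-δ
                (λ s≤s-δ → 0<δ (≤-by (diff-nonneg s≤s-δ) (solve 2 (λ s δ → s :- δ :- s := :0 :- δ) refl s δ))))))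
    ... | inj₂ s-δ<0 = ⊥-elim (neg 0# ≤-refl 0≤s (<⇒≤ s-δ<0) (<⇒≤ 0<f0))

    private
      -- The admissible `a` form an initial segment of [0, t], whose supremum is the first root.
      -- Asking for positivity at `a` alone would let the set jump over a root.
      PositiveUpTo : Carrier → Carrier → Set
      PositiveUpTo t a = 0# ≤ a × a ≤ t × (∀ r → 0# ≤ r → r ≤ a → 0# < f r)

      positiveUpTo-0 : 0# < f 0# → ∀ {t} → 0# ≤ t → PositiveUpTo t 0#
      positiveUpTo-0 0<f0 0≤t with positive-right 0# ≤-refl 0<f0
      ... | (δ , 0<δ , pos) = ≤-refl , 0≤t , λ r 0≤r r≤0 →
        pos r 0≤r (≤-trans r≤0 (+-nonneg ≤-refl (<⇒≤ 0<δ))) (≤-trans r≤0 0≤1)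

      supremum-root : 0# < f 0# → ∀ {t} → 0# ≤ t → t ≤ 1# → f t ≤ 0# → ∀ s →
        (∀ a → PositiveUpTo t a → a ≤ s) → (∀ b → (∀ a → PositiveUpTo t a → a ≤ b) → s ≤ b) →
        0# ≤ s × s ≤ t × f s ≈ 0# × PositiveBelow f s
      supremum-root 0<f0 {t} 0≤t t≤1 ft≤0 s upper least =
        0≤s , s≤t , antisym fs≤0 (nonneg-closure 0<f0 0≤s (≤-trans s≤t t≤1) below) , below
        where
        0≤s : 0# ≤ s
        0≤s = upper 0# (positiveUpTo-0 0<f0 0≤t)

        s≤t : s ≤ t
        s≤t = least t (λ _ Pa → proj₁ (proj₂ Pa))

        below : PositiveBelow f s
        below r 0≤r r<s fr≤0 = r<s (least r bound-by-r)
          where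
          bound-by-r : ∀ a → PositiveUpTo t a → a ≤ r
          bound-by-r a (_ , _ , pos) with ≤⊎> a r
          ... | inj₁ a≤r = a≤r
          ... | inj₂ r<a = ⊥-elim (pos r 0≤r (<⇒≤ r<a) fr≤0)

        -- A positive value at `s` would persist on [s, s + δ]. Either this stretch reaches `t`,
        -- where `f` is not positive, or `s + δ` is admissible and exceeds the supremum.
        fs≤0 : f s ≤ 0#
        fs≤0 with ≤⊎> (f s) 0#
        ... | inj₁ fs≤0 = fs≤0
        ... | inj₂ 0<fs with positive-right s 0≤s 0<fs
        ... | (δ , 0<δ , pos) with ≤⊎> t (s + δ)
        ... | inj₁ t≤s+δ = ⊥-elim (pos t s≤t t≤s+δ t≤1 ft≤0)
        ... | inj₂ s+δ<t = ⊥-elim (0<δ (≤-by (diff-nonneg (upper (s + δ) extended))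
                                    (solve 2 (λ s δ → s :- (s :+ δ) := :0 :- δ) refl s δ)))
          where
          positive : ∀ r → 0# ≤ r → r ≤ s + δ → 0# < f r
          positive r 0≤r r≤s+δ with ≤⊎> s r
          ... | inj₁ s≤r = pos r s≤r r≤s+δ (≤-trans r≤s+δ (≤-trans (<⇒≤ s+δ<t) t≤1))
          ... | inj₂ r<s = below r 0≤r r<s

          extended : PositiveUpTo t (s + δ)
          extended = +-nonneg 0≤s (<⇒≤ 0<δ) , <⇒≤ s+δ<t , positive

    -- Besides a root this yields positivity on everything before it, the hypothesis that keeps the
    -- induction in `dep-positive-∩` going.
    first-root : 0# < f 0# → ∀ t → 0# ≤ t → t ≤ 1# → f t ≤ 0# →
      ∃[ s ] (0# ≤ s × s ≤ t × f s ≈ 0# × PositiveBelow f s)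
    first-root 0<f0 t 0≤t t≤1 ft≤0 =
      let (s , upper , least) = lub (PositiveUpTo t) (0# , positiveUpTo-0 0<f0 0≤t) (t , λ _ Pa → proj₁ (proj₂ Pa))
      in s , supremum-root 0<f0 0≤t t≤1 ft≤0 s upper least

  -- The dependence polynomial and Shearer's measure

  ι : Bool → Carrier
  ι false = 0#
  ι true  = 1#

  ι-∧ : ∀ a b → ι (a ∧ b) ≈ ι a * ι b
  ι-∧ true  b = sym (*-identityˡ _)
  ι-∧ false b = sym (zeroˡ _)

  ι-nonneg : ∀ b → 0# ≤ ι b
  ι-nonneg true  = 0≤1
  ι-nonneg false = ≤-refl

  ι-≤1 : ∀ b → ι b ≤ 1#
  ι-≤1 true  = ≤-refl
  ι-≤1 false = 0≤1

  ι-lookup-∩ : ∀ {n} (U : Vec Bool n) a v → ι (lookup (U ∩ tabulate a) v) ≈ ι (lookup U v) * ι (a v)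
  ι-lookup-∩ U a v = trans (reflexive (≡.cong ι (lookup-∩-tabulate U a v))) (ι-∧ (lookup U v) (a v))

  -- The dependence polynomial ∑ (- t)^|S| over the cliques S inside U, by deletion of the first vertex.
  dep : ∀ {n} → Adjacency n → Vec Bool n → Carrier → Carrier
  dep A []      t = 1#
  dep A (b ∷ U) t = dep (inner A) U t - ι b * t * dep (inner A) (U ∩ neighbours₀ A) t

  dep-lipschitz : ∀ {n} (A : Adjacency n) U → Lipschitz (dep A U)
  dep-lipschitz A []      = lipschitz-1
  dep-lipschitz A (b ∷ U) = lipschitz-step (ι-nonneg b) (ι-≤1 b)
    (dep-lipschitz (inner A) U) (dep-lipschitz (inner A) (U ∩ neighbours₀ A))

  dep-0 : ∀ {n} (A : Adjacency n) U → dep A U 0# ≈ 1#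
  dep-0 A []      = refl
  dep-0 A (b ∷ U) = trans (solve 3 (λ d k e → d :- k :* :0 :* e := d) refl _ (ι b) _) (dep-0 (inner A) U)

  0<dep-0 : ∀ {n} (A : Adjacency n) U → 0# < dep A U 0#
  0<dep-0 A U d≤0 = 0<1 (≤-respˡ (dep-0 A U) d≤0)

  dep-cong : ∀ {n} (A : Adjacency n) {U W} t → U ≡ W → dep A U t ≈ dep A W t
  dep-cong A t ≡.refl = refl

  dep-resp : ∀ {n} (A : Adjacency n) U {s t} → s ≈ t → dep A U s ≈ dep A U t
  dep-resp A []      s≈t = refl
  dep-resp A (b ∷ U) s≈t = +-cong (dep-resp (inner A) U s≈t)
    (-‿cong (*-cong (*-congˡ s≈t) (dep-resp (inner A) (U ∩ neighbours₀ A) s≈t)))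

  dep-false : ∀ {n} (A : Adjacency (suc n)) U t → dep A (false ∷ U) t ≈ dep (inner A) U t
  dep-false A U t = solve 3 (λ d t e → d :- :0 :* t :* e := d) refl _ t _

  -- `dep` peels off the first vertex only. Peeling off the first vertex and `v` in either order
  -- gives the same four terms, with the symmetry of `A` matching the term that contains both.
  dep-delete : ∀ {n} (A : Adjacency n) → Symmetric A → Irreflexive A → ∀ U v t →
    dep A U t ≈ dep A (U [ v ]≔ false) t - ι (lookup U v) * t * dep A (U ∩ neighbours A v) t
  dep-delete A A-sym A-irrefl (b ∷ U) zero t rewrite A-irrefl zero | Bool.∧-zeroʳ b =
    +-cong (sym (dep-false A U t))
      (-‿cong (*-congˡ (sym (dep-false A (U ∩ neighbours₀ A) t))))
  dep-delete A A-sym A-irrefl (b ∷ U) (suc v) t = begin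
    dep A′ U t - ι b * t * dep A′ (U ∩ N) t
      ≈⟨ +-cong (IH U) (-‿cong (*-congˡ (IH (U ∩ N)))) ⟩
    X - u * t * Y - ι b * t * (dep A′ ((U ∩ N) [ v ]≔ false) t - ι (lookup (U ∩ N) v) * t * dep A′ ((U ∩ N) ∩ Nᵥ) t)
      ≈⟨ +-congˡ (-‿cong (*-congˡ (+-cong (dep-cong A′ t (remove-∩ U N v))
           (-‿cong (*-cong (*-congʳ (ι-lookup-∩ U (A zero ∘ suc) v)) (dep-cong A′ t (∩-swap U N Nᵥ))))))) ⟩
    X - u * t * Y - ι b * t * (Z - u * ι (A zero (suc v)) * t * W)
      ≈⟨ solve 8 (λ x y z w u b a t → x :- u :* t :* y :- b :* t :* (z :- u :* a :* t :* w)
           := x :- b :* t :* z :- u :* t :* (y :- b :* a :* t :* w)) refl X Y Z W u (ι b) (ι (A zero (suc v))) t ⟩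
    X - ι b * t * Z - u * t * (Y - ι b * ι (A zero (suc v)) * t * W)
      ≈⟨ +-congˡ (-‿cong (*-congˡ (+-congˡ (-‿cong (*-congʳ (*-congʳ
           (trans (sym (ι-∧ b _)) (reflexive (≡.cong (λ a → ι (b ∧ a)) (A-sym zero (suc v)))))))))) ) ⟩
    X - ι b * t * Z - u * t * (Y - ι (b ∧ A (suc v) zero) * t * W)
      ∎
    where
    A′ = inner A
    N = neighbours₀ A
    Nᵥ = neighbours A′ v
    u = ι (lookup U v)
    IH = λ V → dep-delete A′ (λ i j → A-sym (suc i) (suc j)) (λ i → A-irrefl (suc i)) V v t
    X = dep A′ (U [ v ]≔ false) t
    Y = dep A′ (U ∩ Nᵥ) t
    Z = dep A′ ((U [ v ]≔ false) ∩ N) t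
    W = dep A′ ((U ∩ Nᵥ) ∩ N) t

  module _ {n} (A : Adjacency n) (A-sym : Symmetric A) (A-irrefl : Irreflexive A) where

    -- At the first root s of dep (U ∖ v), deletion gives dep U s = - s * dep (U ∩ N(v)) s ≤ 0.
    dep-positive-∩ : ∀ k U W {a} → size U ℕ.≤ k → a ≤ 1# →
      PositiveBelow (dep A U) a → PositiveBelow (dep A (U ∩ W)) a
    dep-positive-∩ k U W |U|≤k a≤1 pos with ∩-absorbs⊎missing U W
    ... | inj₁ U∩W≡U rewrite U∩W≡U = pos
    dep-positive-∩ zero U W |U|≤0 a≤1 pos | inj₂ (v , v∈U , v∉W)
      with () ← ≡.trans (size-remove U v v∈U) (ℕ.n≤0⇒n≡0 |U|≤0)
    dep-positive-∩ (suc k) U W {a} |U|≤k a≤1 pos | inj₂ (v , v∈U , v∉W) =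
      ≡.subst (λ V → PositiveBelow (dep A V) a) (remove-∩-absent U W v v∉W)
        (dep-positive-∩ k U⁻ W |U⁻|≤k a≤1 pos⁻)
      where
      U⁻ = U [ v ]≔ false
      Nᵥ = neighbours A v

      |U⁻|≤k : size U⁻ ℕ.≤ k
      |U⁻|≤k = ℕ.≤-pred (ℕ.≤-trans (ℕ.≤-reflexive (size-remove U v v∈U)) |U|≤k)

      pos⁻ : PositiveBelow (dep A U⁻) a
      pos⁻ r 0≤r r<a d≤0 =
        let r≤1 = ≤-trans (<⇒≤ r<a) a≤1
            (s , 0≤s , s≤r , ds≈0 , below) = first-root (dep-lipschitz A U⁻) (0<dep-0 A U⁻) r 0≤r r≤1 d≤0
            s≤1 = ≤-trans s≤r r≤1
            -- As `v` is not its own neighbour, `U ∩ Nᵥ` equals `U⁻ ∩ Nᵥ`, and the induction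
            -- hypothesis for `U⁻` applies with `s` in place of `a`.
            0≤dN = nonneg-closure (dep-lipschitz A (U⁻ ∩ Nᵥ)) (0<dep-0 A (U⁻ ∩ Nᵥ)) 0≤s s≤1
                     (dep-positive-∩ k U⁻ Nᵥ |U⁻|≤k s≤1 below)
        in pos s 0≤s (≤-<-trans s≤r r<a) (≤-by (*-nonneg 0≤s 0≤dN) (begin
          s * dep A (U⁻ ∩ Nᵥ) s
            ≈⟨ *-congˡ (dep-cong A s (remove-∩-absent U Nᵥ v (≡.trans (Vec.lookup∘tabulate (A v) v) (A-irrefl v)))) ⟩
          s * dep A (U ∩ Nᵥ) s
            ≈⟨ solve 2 (λ s d → s :* d := :0 :- (:0 :- :1 :* s :* d)) refl s _ ⟩
          0# - (0# - 1# * s * dep A (U ∩ Nᵥ) s)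
            ≈⟨ +-congˡ (-‿cong (+-cong ds≈0 (-‿cong (*-congʳ (*-congʳ (reflexive (≡.cong ι v∈U))))))) ⟨
          0# - (dep A U⁻ s - ι (lookup U v) * s * dep A (U ∩ Nᵥ) s)
            ≈⟨ +-congˡ (-‿cong (dep-delete A A-sym A-irrefl U v s)) ⟨
          0# - dep A U s
            ∎))

  -- Shearer's measure: each vertex of U occurs with probability t, adjacent vertices
  -- are independent and nonadjacent vertices exclude each other.
  weight : ∀ {n} → Carrier → Adjacency n → Vec Bool n → Vec Bool n → Carrier
  weight t A []      []          = 1#
  weight t A (b ∷ U) (false ∷ S) =
    weight t (inner A) U S - ι b * t * weight t (inner A) (U ∩ neighbours₀ A) S
  weight t A (b ∷ U) (true ∷ S)  = ι b * t * weight t (inner A) (U ∩ neighbours₀ A) S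

  -- This is t^|S| if `S` is a clique inside `U` and 0 otherwise: the probability that X contains
  -- `S`.
  cliqueWeight : ∀ {n} → Carrier → Adjacency n → Vec Bool n → Vec Bool n → Carrier
  cliqueWeight t A []      []          = 1#
  cliqueWeight t A (b ∷ U) (false ∷ S) = cliqueWeight t (inner A) U S
  cliqueWeight t A (b ∷ U) (true ∷ S)  = ι b * t * cliqueWeight t (inner A) (U ∩ neighbours₀ A) S

  cliqueWeight-nonneg : ∀ {n t} → 0# ≤ t → (A : Adjacency n) → ∀ U S → 0# ≤ cliqueWeight t A U S
  cliqueWeight-nonneg 0≤t A []      []          = 0≤1
  cliqueWeight-nonneg 0≤t A (b ∷ U) (false ∷ S) = cliqueWeight-nonneg 0≤t (inner A) U S
  cliqueWeight-nonneg 0≤t A (b ∷ U) (true ∷ S)  =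
    *-nonneg (*-nonneg (ι-nonneg b) 0≤t) (cliqueWeight-nonneg 0≤t (inner A) (U ∩ neighbours₀ A) S)

  cliqueWeight-∩ : ∀ {n} t (A : Adjacency n) U W S →
    cliqueWeight t A (U ∩ W) S ≈ ι (subset S W) * cliqueWeight t A U S
  cliqueWeight-∩ t A []      []      []          = sym (*-identityˡ _)
  cliqueWeight-∩ t A (b ∷ U) (w ∷ W) (false ∷ S) = cliqueWeight-∩ t (inner A) U W S
  cliqueWeight-∩ t A (b ∷ U) (w ∷ W) (true ∷ S)  = begin
    ι (b ∧ w) * t * cliqueWeight t A′ ((U ∩ W) ∩ N) S
      ≡⟨ ≡.cong (λ V → ι (b ∧ w) * t * cliqueWeight t A′ V S) (∩-swap U W N) ⟩
    ι (b ∧ w) * t * cliqueWeight t A′ ((U ∩ N) ∩ W) S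
      ≈⟨ *-cong (*-congʳ (ι-∧ b w)) (cliqueWeight-∩ t A′ (U ∩ N) W S) ⟩
    ι b * ι w * t * (ι (subset S W) * h)
      ≈⟨ solve 5 (λ b w t s h → b :* w :* t :* (s :* h) := w :* s :* (b :* t :* h)) refl (ι b) (ι w) t _ h ⟩
    ι w * ι (subset S W) * (ι b * t * h)
      ≈⟨ *-congʳ (ι-∧ w _) ⟨
    ι (w ∧ subset S W) * (ι b * t * h)
      ∎
    where
    A′ = inner A
    N = neighbours₀ A
    h = cliqueWeight t A′ (U ∩ N) S

  -- Inclusion-exclusion over the cliques containing `S`: each is `S` together with a clique among
  -- its common neighbours, which contributes a power of `- t`.
  weight-factor : ∀ {n} t (A : Adjacency n) U S →
    weight t A U S ≈ cliqueWeight t A U S * dep A (commonNeighbours A U S) t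
  weight-factor t A []      []          = sym (*-identityˡ _)
  weight-factor t A (b ∷ U) (false ∷ S) = begin
    weight t A′ U S - ι b * t * weight t A′ (U ∩ N) S
      ≈⟨ +-cong (weight-factor t A′ U S) (-‿cong (*-congˡ (weight-factor t A′ (U ∩ N) S))) ⟩
    h * d - ι b * t * (cliqueWeight t A′ (U ∩ N) S * dep A′ (commonNeighbours A′ (U ∩ N) S) t)
      ≈⟨ +-congˡ (-‿cong (*-congˡ (*-cong (cliqueWeight-∩ t A′ U N S) (dep-cong A′ t (commonNeighbours-∩ A′ U N S))))) ⟩
    h * d - ι b * t * (ι s * h * e)
      ≈⟨ solve 6 (λ h d b t s e → h :* d :- b :* t :* (s :* h :* e) := h :* (d :- b :* s :* t :* e)) refl h d (ι b) t (ι s) e ⟩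
    h * (d - ι b * ι s * t * e)
      ≈⟨ *-congˡ (+-congˡ (-‿cong (*-congʳ (*-congʳ (ι-∧ b s))))) ⟨
    h * (d - ι (b ∧ s) * t * e)
      ∎
    where
    A′ = inner A
    N = neighbours₀ A
    s = subset S N
    h = cliqueWeight t A′ U S
    d = dep A′ (commonNeighbours A′ U S) t
    e = dep A′ (commonNeighbours A′ U S ∩ N) t
  weight-factor t A (b ∷ U) (true ∷ S)  = begin
    ι b * t * weight t A′ (U ∩ N) S
      ≈⟨ *-congˡ (weight-factor t A′ (U ∩ N) S) ⟩
    ι b * t * (cliqueWeight t A′ (U ∩ N) S * dep A′ (commonNeighbours A′ (U ∩ N) S) t)
      ≈⟨ *-assoc _ _ _ ⟨
    ι b * t * cliqueWeight t A′ (U ∩ N) S * dep A′ (commonNeighbours A′ (U ∩ N) S) t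
      ≈⟨ *-congˡ (dep-false A (commonNeighbours A′ (U ∩ N) S) t) ⟨
    ι b * t * cliqueWeight t A′ (U ∩ N) S * dep A (false ∷ commonNeighbours A′ (U ∩ N) S) t
      ∎
    where
    A′ = inner A
    N = neighbours₀ A

  weight-nonneg : ∀ {n t} → 0# ≤ t → (A : Adjacency n) → (∀ W → 0# ≤ dep A W t) → ∀ U S → 0# ≤ weight t A U S
  weight-nonneg {t = t} 0≤t A 0≤dep U S = ≤-respʳ (sym (weight-factor t A U S))
    (*-nonneg (cliqueWeight-nonneg 0≤t A U S) (0≤dep (commonNeighbours A U S)))

  -- Moments of Shearer's measure

  open Sum semiring using (sum; sum-cong-≋; sum-replicate-zero; ∑-distrib-+; ∑-comm; *-distribˡ-sum; *-distribʳ-sum)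

  sumSubsets : ∀ {n} → (Vec Bool n → Carrier) → Carrier
  sumSubsets {zero}  f = f []
  sumSubsets {suc n} f = sumSubsets (λ S → f (false ∷ S)) + sumSubsets (λ S → f (true ∷ S))

  sumSubsets-cong : ∀ {n} {f g : Vec Bool n → Carrier} → (∀ S → f S ≈ g S) → sumSubsets f ≈ sumSubsets g
  sumSubsets-cong {zero}  f≈g = f≈g []
  sumSubsets-cong {suc n} f≈g = +-cong (sumSubsets-cong (λ S → f≈g (false ∷ S))) (sumSubsets-cong (λ S → f≈g (true ∷ S)))

  sumSubsets-+ : ∀ {n} (f g : Vec Bool n → Carrier) → sumSubsets (λ S → f S + g S) ≈ sumSubsets f + sumSubsets g
  sumSubsets-+ {zero}  f g = refl
  sumSubsets-+ {suc n} f g = trans (+-cong (sumSubsets-+ (f ∘ (false ∷_)) (g ∘ (false ∷_))) (sumSubsets-+ (f ∘ (true ∷_)) (g ∘ (true ∷_))))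
    (solve 4 (λ a b c d → a :+ b :+ (c :+ d) := a :+ c :+ (b :+ d)) refl _ _ _ _)

  sumSubsets-* : ∀ {n} k (f : Vec Bool n → Carrier) → sumSubsets (λ S → k * f S) ≈ k * sumSubsets f
  sumSubsets-* {zero}  k f = refl
  sumSubsets-* {suc n} k f = trans (+-cong (sumSubsets-* k (f ∘ (false ∷_))) (sumSubsets-* k (f ∘ (true ∷_)))) (sym (distribˡ k _ _))

  sumSubsets-nonneg : ∀ {n} {f : Vec Bool n → Carrier} → (∀ S → 0# ≤ f S) → 0# ≤ sumSubsets f
  sumSubsets-nonneg {zero}  0≤f = 0≤f []
  sumSubsets-nonneg {suc n} 0≤f = +-nonneg (sumSubsets-nonneg (λ S → 0≤f (false ∷ S))) (sumSubsets-nonneg (λ S → 0≤f (true ∷ S)))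

  +-≈0 : ∀ {a b} → 0# ≤ a → 0# ≤ b → a + b ≈ 0# → a ≈ 0# × b ≈ 0#
  +-≈0 {a} {b} 0≤a 0≤b a+b≈0 =
    antisym (≤-respˡ (+-identityʳ a) (≤-respʳ a+b≈0 (+-mono ≤-refl 0≤b))) 0≤a ,
    antisym (≤-respˡ (+-identityˡ b) (≤-respʳ a+b≈0 (+-mono 0≤a ≤-refl))) 0≤b

  sumSubsets-≈0 : ∀ {n} {f : Vec Bool n → Carrier} → (∀ S → 0# ≤ f S) → sumSubsets f ≈ 0# → ∀ S → f S ≈ 0#
  sumSubsets-≈0 0≤f ∑≈0 []      = ∑≈0
  sumSubsets-≈0 0≤f ∑≈0 (s ∷ S)
    with +-≈0 (sumSubsets-nonneg (λ S → 0≤f (false ∷ S))) (sumSubsets-nonneg (λ S → 0≤f (true ∷ S))) ∑≈0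
  sumSubsets-≈0 0≤f ∑≈0 (false ∷ S) | (≈0 , _) = sumSubsets-≈0 (λ S → 0≤f (false ∷ S)) ≈0 S
  sumSubsets-≈0 0≤f ∑≈0 (true ∷ S)  | (_ , ≈0) = sumSubsets-≈0 (λ S → 0≤f (true ∷ S)) ≈0 S

  card : ∀ {n} → Vec Bool n → Carrier
  card []      = 0#
  card (b ∷ U) = ι b + card U

  card-sum : ∀ {n} (U : Vec Bool n) → card U ≈ sum (λ i → ι (lookup U i))
  card-sum []      = refl
  card-sum (b ∷ U) = +-congˡ (card-sum U)

  mem : ∀ {n} → Fin n → Vec Bool n → Carrier
  mem v S = ι (lookup S v)

  module Expectation (t : Carrier) where

    -- The moment formulas are polynomial identities valid for every `t`; the sign of the weights
    -- enters only in `weight-concentrated`.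
    E : ∀ {n} → Adjacency n → Vec Bool n → (Vec Bool n → Carrier) → Carrier
    E A U f = sumSubsets (λ S → weight t A U S * f S)

    E-cong : ∀ {n} (A : Adjacency n) U {f g} → (∀ S → f S ≈ g S) → E A U f ≈ E A U g
    E-cong {n} A U f≈g = sumSubsets-cong {n} (λ S → *-congˡ (f≈g S))

    E-+ : ∀ {n} (A : Adjacency n) U f g → E A U (λ S → f S + g S) ≈ E A U f + E A U g
    E-+ {n} A U f g = trans (sumSubsets-cong {n} (λ S → distribˡ (weight t A U S) (f S) (g S)))
      (sumSubsets-+ {n} (λ S → weight t A U S * f S) (λ S → weight t A U S * g S))

    E-* : ∀ {n} (A : Adjacency n) U k f → E A U (λ S → k * f S) ≈ k * E A U f
    E-* {n} A U k f = trans
      (sumSubsets-cong {n} (λ S → solve 3 (λ q k f → q :* (k :* f) := k :* (q :* f)) refl (weight t A U S) k (f S)))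
      (sumSubsets-* {n} k (λ S → weight t A U S * f S))

    E-0 : ∀ {n} (A : Adjacency n) U → E A U (λ _ → 0#) ≈ 0#
    E-0 A U = trans (E-cong A U (λ _ → sym (zeroˡ 0#))) (trans (E-* A U 0# (λ _ → 0#)) (zeroˡ _))

    E-sum : ∀ {n m} (A : Adjacency n) U (f : Fin m → Vec Bool n → Carrier) →
      E A U (λ S → sum (λ i → f i S)) ≈ sum (λ i → E A U (f i))
    E-sum {m = zero}  A U f = E-0 A U
    E-sum {m = suc m} A U f = trans (E-+ A U (f zero) (λ S → sum (λ i → f (suc i) S))) (+-congˡ (E-sum A U (f ∘ suc)))

    -- `g` is the value without the first vertex and `h` the increment when it is included. The
    -- weights of `false ∷ S` and `true ∷ S` add up to the weight of `S` in `U`, which leaves one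
    -- term for each function.
    E-step : ∀ {n} (A : Adjacency (suc n)) b U f g h →
      (∀ S → f (false ∷ S) ≈ g S) → (∀ S → f (true ∷ S) ≈ g S + h S) →
      E A (b ∷ U) f ≈ E (inner A) U g + ι b * t * E (inner A) (U ∩ neighbours₀ A) h
    E-step {n} A b U f g h f₀ f₁ = begin
      E A (b ∷ U) f
        ≈⟨ sumSubsets-+ {n} (λ S → (w S - ι b * t * w′ S) * f (false ∷ S)) (λ S → ι b * t * w′ S * f (true ∷ S)) ⟨
      sumSubsets (λ S → (w S - ι b * t * w′ S) * f (false ∷ S) + ι b * t * w′ S * f (true ∷ S))
        ≈⟨ sumSubsets-cong {n} (λ S → trans (+-cong (*-congˡ (f₀ S)) (*-congˡ (f₁ S)))
             (solve 6 (λ w w′ b t g h → (w :- b :* t :* w′) :* g :+ b :* t :* w′ :* (g :+ h)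
                := w :* g :+ b :* t :* (w′ :* h)) refl (w S) (w′ S) (ι b) t (g S) (h S))) ⟩
      sumSubsets (λ S → w S * g S + ι b * t * (w′ S * h S))
        ≈⟨ trans (sumSubsets-+ {n} (λ S → w S * g S) (λ S → ι b * t * (w′ S * h S)))
             (+-congˡ (sumSubsets-* {n} (ι b * t) (λ S → w′ S * h S))) ⟩
      E (inner A) U g + ι b * t * E (inner A) (U ∩ neighbours₀ A) h
        ∎
      where
      w w′ : Vec Bool n → Carrier
      w = weight t (inner A) U
      w′ = weight t (inner A) (U ∩ neighbours₀ A)

    E-step-const : ∀ {n} (A : Adjacency (suc n)) b U f g →
      (∀ S → f (false ∷ S) ≈ g S) → (∀ S → f (true ∷ S) ≈ g S) → E A (b ∷ U) f ≈ E (inner A) U g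
    E-step-const A b U f g f₀ f₁ = begin
      E A (b ∷ U) f
        ≈⟨ E-step A b U f g (λ _ → 0#) f₀ (λ S → trans (f₁ S) (sym (+-identityʳ _))) ⟩
      E (inner A) U g + ι b * t * E (inner A) (U ∩ neighbours₀ A) (λ _ → 0#)
        ≈⟨ +-congˡ (trans (*-congˡ (E-0 (inner A) (U ∩ neighbours₀ A))) (zeroʳ _)) ⟩
      E (inner A) U g + 0#
        ≈⟨ +-identityʳ _ ⟩
      E (inner A) U g
        ∎

    E-step-zero : ∀ {n} (A : Adjacency (suc n)) b U f h →
      (∀ S → f (false ∷ S) ≈ 0#) → (∀ S → f (true ∷ S) ≈ h S) →
      E A (b ∷ U) f ≈ ι b * t * E (inner A) (U ∩ neighbours₀ A) h
    E-step-zero A b U f h f₀ f₁ = begin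
      E A (b ∷ U) f
        ≈⟨ E-step A b U f (λ _ → 0#) h f₀ (λ S → trans (f₁ S) (sym (+-identityˡ _))) ⟩
      E (inner A) U (λ _ → 0#) + ι b * t * E (inner A) (U ∩ neighbours₀ A) h
        ≈⟨ trans (+-congʳ (E-0 (inner A) U)) (+-identityˡ _) ⟩
      ι b * t * E (inner A) (U ∩ neighbours₀ A) h
        ∎

    E-1 : ∀ {n} (A : Adjacency n) U → E A U (λ _ → 1#) ≈ 1#
    E-1 A []      = *-identityˡ 1#
    E-1 A (b ∷ U) = trans (E-step-const A b U (λ _ → 1#) (λ _ → 1#) (λ _ → refl) (λ _ → refl)) (E-1 (inner A) U)

    E-mem : ∀ {n} (A : Adjacency n) U v → E A U (mem v) ≈ ι (lookup U v) * t
    E-mem A (b ∷ U) zero    = trans (E-step-zero A b U (mem zero) (λ _ → 1#) (λ _ → refl) (λ _ → refl))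
      (trans (*-congˡ (E-1 (inner A) (U ∩ neighbours₀ A))) (*-identityʳ _))
    E-mem A (b ∷ U) (suc v) = trans (E-step-const A b U (mem (suc v)) (mem v) (λ _ → refl) (λ _ → refl)) (E-mem (inner A) U v)

    E-card : ∀ {n} (A : Adjacency n) U → E A U card ≈ t * card U
    E-card A []      = solve 1 (λ t → :1 :* :0 := t :* :0) refl t
    E-card A (b ∷ U) = begin
      E A (b ∷ U) card
        ≈⟨ E-step A b U card card (λ _ → 1#) (λ _ → +-identityˡ _) (λ _ → +-comm 1# _) ⟩
      E (inner A) U card + ι b * t * E (inner A) (U ∩ neighbours₀ A) (λ _ → 1#)
        ≈⟨ +-cong (E-card (inner A) U) (*-congˡ (E-1 (inner A) (U ∩ neighbours₀ A))) ⟩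
      t * card U + ι b * t * 1#
        ≈⟨ solve 3 (λ t c b → t :* c :+ b :* t :* :1 := t :* (b :+ c)) refl t _ (ι b) ⟩
      t * (ι b + card U)
        ∎

    -- Given that `v` occurs, the rest of X follows Shearer's measure on the neighbours of `v`, with
    -- mean `t` times their number. The 1 counts `v` itself.
    E-mem-card : ∀ {n} (A : Adjacency n) → Symmetric A → Irreflexive A → ∀ U v →
      E A U (λ S → mem v S * card S) ≈ ι (lookup U v) * t * (1# + t * card (U ∩ neighbours A v))
    E-mem-card A A-sym A-irrefl (b ∷ U) zero = begin
      E A (b ∷ U) (λ S → mem zero S * card S)
        ≈⟨ E-step-zero A b U (λ S → mem zero S * card S) (λ S → 1# + card S) (λ _ → zeroˡ _) (λ _ → *-identityˡ _) ⟩
      ι b * t * E A′ UN (λ S → 1# + card S)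
        ≈⟨ *-congˡ (trans (E-+ A′ UN (λ _ → 1#) card) (+-cong (E-1 A′ UN) (E-card A′ UN))) ⟩
      ι b * t * (1# + t * card UN)
        ≈⟨ *-congˡ (+-congˡ (*-congˡ (trans (+-congʳ (reflexive (≡.cong ι b∧A₀₀))) (+-identityˡ _)))) ⟨
      ι b * t * (1# + t * (ι (b ∧ A zero zero) + card UN))
        ∎
      where
      A′ = inner A
      UN = U ∩ neighbours₀ A
      b∧A₀₀ : b ∧ A zero zero ≡ false
      b∧A₀₀ = ≡.trans (≡.cong (b ∧_) (A-irrefl zero)) (Bool.∧-zeroʳ b)
    E-mem-card A A-sym A-irrefl (b ∷ U) (suc v) = begin
      E A (b ∷ U) (λ S → mem (suc v) S * card S)
        ≈⟨ E-step A b U (λ S → mem (suc v) S * card S) (λ S → mem v S * card S) (mem v) (λ _ → *-congˡ (+-identityˡ _))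
             (λ _ → solve 2 (λ m c → m :* (:1 :+ c) := m :* c :+ m) refl _ _) ⟩
      E A′ U (λ S → mem v S * card S) + ι b * t * E A′ (U ∩ neighbours₀ A) (mem v)
        ≈⟨ +-cong (E-mem-card A′ (λ i j → A-sym (suc i) (suc j)) (A-irrefl ∘ suc) U v)
             (*-congˡ (trans (E-mem A′ (U ∩ neighbours₀ A) v) (*-congʳ (ι-lookup-∩ U _ v)))) ⟩
      u * t * (1# + t * c) + ι b * t * (u * ι (A zero (suc v)) * t)
        ≈⟨ solve 5 (λ u t c b a → u :* t :* (:1 :+ t :* c) :+ b :* t :* (u :* a :* t)
              := u :* t :* (:1 :+ t :* (b :* a :+ c))) refl u t c (ι b) _ ⟩
      u * t * (1# + t * (ι b * ι (A zero (suc v)) + c))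
        ≈⟨ *-congˡ (+-congˡ (*-congˡ (+-congʳ (trans (sym (ι-∧ b _)) (reflexive (≡.cong (λ a → ι (b ∧ a)) (A-sym zero (suc v)))))))) ⟩
      u * t * (1# + t * (ι (b ∧ A (suc v) zero) + c))
        ∎
      where
      A′ = inner A
      u = ι (lookup U v)
      c = card (U ∩ neighbours A′ v)

    E-mem² : ∀ {n} (A : Adjacency n) → Symmetric A → ∀ U u v → u ≢ v →
      E A U (λ S → mem u S * mem v S) ≈ ι (lookup U u) * ι (lookup U v) * ι (A u v) * (t * t)
    E-mem² A A-sym (b ∷ U) zero zero u≢v = ⊥-elim (u≢v ≡.refl)
    E-mem² A A-sym (b ∷ U) zero (suc v) u≢v = begin
      E A (b ∷ U) (λ S → mem zero S * mem (suc v) S)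
        ≈⟨ E-step-zero A b U (λ S → mem zero S * mem (suc v) S) (mem v) (λ _ → zeroˡ _) (λ _ → *-identityˡ _) ⟩
      ι b * t * E (inner A) (U ∩ neighbours₀ A) (mem v)
        ≈⟨ *-congˡ (trans (E-mem (inner A) (U ∩ neighbours₀ A) v) (*-congʳ (ι-lookup-∩ U _ v))) ⟩
      ι b * t * (ι (lookup U v) * ι (A zero (suc v)) * t)
        ≈⟨ solve 4 (λ b t v a → b :* t :* (v :* a :* t) := b :* v :* a :* (t :* t)) refl (ι b) t _ _ ⟩
      ι b * ι (lookup U v) * ι (A zero (suc v)) * (t * t)
        ∎
    E-mem² A A-sym (b ∷ U) (suc u) zero u≢v = begin
      E A (b ∷ U) (λ S → mem (suc u) S * mem zero S)
        ≈⟨ E-cong A (b ∷ U) (λ S → *-comm (mem (suc u) S) (mem zero S)) ⟩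
      E A (b ∷ U) (λ S → mem zero S * mem (suc u) S)
        ≈⟨ E-mem² A A-sym (b ∷ U) zero (suc u) (λ ()) ⟩
      ι b * ι (lookup U u) * ι (A zero (suc u)) * (t * t)
        ≈⟨ *-congʳ (*-cong (*-comm _ _) (reflexive (≡.cong ι (A-sym zero (suc u))))) ⟩
      ι (lookup U u) * ι b * ι (A (suc u) zero) * (t * t)
        ∎
    E-mem² A A-sym (b ∷ U) (suc u) (suc v) u≢v =
      trans (E-step-const A b U (λ S → mem (suc u) S * mem (suc v) S) (λ S → mem u S * mem v S) (λ _ → refl) (λ _ → refl))
        (E-mem² (inner A) (λ i j → A-sym (suc i) (suc j)) U u v (u≢v ∘ ≡.cong suc))

    -- As in `E-mem-card`, but conditioned on an edge: 2 for its ends and `t` for each common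
    -- neighbour.
    E-mem²-card : ∀ {n} (A : Adjacency n) → Symmetric A → Irreflexive A → ∀ U u v → u ≢ v →
      E A U (λ S → mem u S * mem v S * card S)
        ≈ ι (lookup U u) * ι (lookup U v) * ι (A u v) * (t * t)
          * (1# + 1# + t * card ((U ∩ neighbours A u) ∩ neighbours A v))
    E-mem²-card A A-sym A-irrefl (b ∷ U) zero zero u≢v = ⊥-elim (u≢v ≡.refl)
    E-mem²-card A A-sym A-irrefl (b ∷ U) zero (suc v) u≢v = begin
      E A (b ∷ U) (λ S → mem zero S * mem (suc v) S * card S)
        ≈⟨ E-step-zero A b U (λ S → mem zero S * mem (suc v) S * card S) (λ S → mem v S + mem v S * card S)
             (λ _ → solve 2 (λ m c → :0 :* m :* c := :0) refl _ _)
             (λ _ → solve 2 (λ m c → :1 :* m :* (:1 :+ c) := m :+ m :* c) refl _ _) ⟩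
      ι b * t * E A′ UN (λ S → mem v S + mem v S * card S)
        ≈⟨ *-congˡ (trans (E-+ A′ UN (mem v) (λ S → mem v S * card S)) (+-cong (E-mem A′ UN v)
             (E-mem-card A′ (λ i j → A-sym (suc i) (suc j)) (A-irrefl ∘ suc) UN v))) ⟩
      ι b * t * (ι (lookup UN v) * t + ι (lookup UN v) * t * (1# + t * c))
        ≈⟨ *-congˡ (+-cong (*-congʳ (ι-lookup-∩ U _ v)) (*-congʳ (*-congʳ (ι-lookup-∩ U _ v)))) ⟩
      ι b * t * (ι (lookup U v) * a * t + ι (lookup U v) * a * t * (1# + t * c))
        ≈⟨ solve 5 (λ b t v a c → b :* t :* (v :* a :* t :+ v :* a :* t :* (:1 :+ t :* c))
              := b :* v :* a :* (t :* t) :* (:1 :+ :1 :+ t :* (:0 :+ c))) refl (ι b) t (ι (lookup U v)) a c ⟩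
      ι b * ι (lookup U v) * a * (t * t) * (1# + 1# + t * (0# + c))
        ≡⟨ ≡.cong (λ z → ι b * ι (lookup U v) * a * (t * t) * (1# + 1# + t * (ι z + c))) b∧A₀₀∧ ⟨
      ι b * ι (lookup U v) * a * (t * t) * (1# + 1# + t * (ι ((b ∧ A zero zero) ∧ A (suc v) zero) + c))
        ∎
      where
      A′ = inner A
      UN = U ∩ neighbours₀ A
      a = ι (A zero (suc v))
      c = card (UN ∩ neighbours A′ v)
      b∧A₀₀∧ : (b ∧ A zero zero) ∧ A (suc v) zero ≡ false
      b∧A₀₀∧ = ≡.cong (_∧ A (suc v) zero) (≡.trans (≡.cong (b ∧_) (A-irrefl zero)) (Bool.∧-zeroʳ b))
    E-mem²-card A A-sym A-irrefl (b ∷ U) (suc u) zero u≢v = begin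
      E A (b ∷ U) (λ S → mem (suc u) S * mem zero S * card S)
        ≈⟨ E-cong A (b ∷ U) (λ S → *-congʳ {card S} (*-comm (mem (suc u) S) (mem zero S))) ⟩
      E A (b ∷ U) (λ S → mem zero S * mem (suc u) S * card S)
        ≈⟨ E-mem²-card A A-sym A-irrefl (b ∷ U) zero (suc u) (λ ()) ⟩
      ι b * ι (lookup U u) * ι (A zero (suc u)) * (t * t) * (1# + 1# + t * card (((b ∷ U) ∩ neighbours A zero) ∩ neighbours A (suc u)))
        ≈⟨ *-cong (*-congʳ (*-cong (*-comm _ _) (reflexive (≡.cong ι (A-sym zero (suc u))))))
             (reflexive (≡.cong (λ V → 1# + 1# + t * card V) (∩-swap (b ∷ U) (neighbours A zero) (neighbours A (suc u))))) ⟩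
      ι (lookup U u) * ι b * ι (A (suc u) zero) * (t * t) * (1# + 1# + t * card (((b ∷ U) ∩ neighbours A (suc u)) ∩ neighbours A zero))
        ∎
    E-mem²-card A A-sym A-irrefl (b ∷ U) (suc u) (suc v) u≢v = begin
      E A (b ∷ U) (λ S → mem (suc u) S * mem (suc v) S * card S)
        ≈⟨ E-step A b U (λ S → mem (suc u) S * mem (suc v) S * card S) (λ S → mem u S * mem v S * card S) (λ S → mem u S * mem v S)
             (λ _ → *-congˡ (+-identityˡ _)) (λ _ → solve 2 (λ m c → m :* (:1 :+ c) := m :* c :+ m) refl _ _) ⟩
      E A′ U (λ S → mem u S * mem v S * card S) + ι b * t * E A′ (U ∩ N) (λ S → mem u S * mem v S)
        ≈⟨ +-cong (E-mem²-card A′ A′-sym (A-irrefl ∘ suc) U u v u≢v′)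
             (*-congˡ (trans (E-mem² A′ A′-sym (U ∩ N) u v u≢v′)
               (*-congʳ (*-congʳ (*-cong (ι-lookup-∩ U _ u) (ι-lookup-∩ U _ v)))))) ⟩
      p * q * a * (t * t) * (1# + 1# + t * c) + ι b * t * (p * d * (q * e) * a * (t * t))
        ≈⟨ solve 8 (λ p q a t c b d e → p :* q :* a :* (t :* t) :* (:1 :+ :1 :+ t :* c) :+ b :* t :* (p :* d :* (q :* e) :* a :* (t :* t))
              := p :* q :* a :* (t :* t) :* (:1 :+ :1 :+ t :* (b :* d :* e :+ c))) refl p q a t c (ι b) d e ⟩
      p * q * a * (t * t) * (1# + 1# + t * (ι b * d * e + c))
        ≈⟨ *-congˡ (+-congˡ (*-congˡ (+-congʳ b∧d∧e))) ⟨
      p * q * a * (t * t) * (1# + 1# + t * (ι ((b ∧ A (suc u) zero) ∧ A (suc v) zero) + c))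
        ∎
      where
      A′ = inner A
      N = neighbours₀ A
      A′-sym : Symmetric A′
      A′-sym i j = A-sym (suc i) (suc j)
      u≢v′ : u ≢ v
      u≢v′ = u≢v ∘ ≡.cong suc
      p = ι (lookup U u)
      q = ι (lookup U v)
      a = ι (A (suc u) (suc v))
      d = ι (A zero (suc u))
      e = ι (A zero (suc v))
      c = card ((U ∩ neighbours A′ u) ∩ neighbours A′ v)
      b∧d∧e : ι ((b ∧ A (suc u) zero) ∧ A (suc v) zero) ≈ ι b * d * e
      b∧d∧e = trans (ι-∧ (b ∧ A (suc u) zero) (A (suc v) zero)) (*-cong (trans (ι-∧ b (A (suc u) zero)) (*-congˡ (reflexive (≡.cong ι (A-sym (suc u) zero)))))
        (reflexive (≡.cong ι (A-sym (suc v) zero))))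

  -- The equality case of the variance bound

  sum-nonneg : ∀ {n} (f : Fin n → Carrier) → (∀ i → 0# ≤ f i) → 0# ≤ sum f
  sum-nonneg {zero}  f 0≤f = ≤-refl
  sum-nonneg {suc n} f 0≤f = +-nonneg (0≤f zero) (sum-nonneg (f ∘ suc) (0≤f ∘ suc))

  sum-≈0 : ∀ {n} (f : Fin n → Carrier) → (∀ i → 0# ≤ f i) → sum f ≈ 0# → ∀ i → f i ≈ 0#
  sum-≈0 {suc n} f 0≤f ∑≈0 i with +-≈0 (0≤f zero) (sum-nonneg (f ∘ suc) (0≤f ∘ suc)) ∑≈0
  sum-≈0 {suc n} f 0≤f ∑≈0 zero    | (≈0 , _) = ≈0
  sum-≈0 {suc n} f 0≤f ∑≈0 (suc i) | (_ , ≈0) = sum-≈0 (f ∘ suc) (0≤f ∘ suc) ≈0 i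

  card-⊤ : ∀ n → card (Subset.⊤ {n}) ≈ nat n
  card-⊤ zero    = refl
  card-⊤ (suc n) = +-congˡ (card-⊤ n)

  sum-const : ∀ n a → sum {n} (λ _ → a) ≈ nat n * a
  sum-const zero    a = sym (zeroˡ a)
  sum-const (suc n) a = trans (+-cong (sym (*-identityˡ a)) (sum-const n a)) (sym (distribʳ a 1# _))

  -- Inclusion-exclusion; applied to two neighbourhoods it counts the common nonneighbours.
  sum-complements : ∀ {n} (a b : Fin n → Bool) →
    sum (λ i → (1# - ι (a i)) * (1# - ι (b i)))
      ≈ nat n - card (tabulate a) - card (tabulate b) + card (tabulate a ∩ tabulate b)
  sum-complements {zero}  a b = solve 0 (:0 := :0 :- :0 :- :0 :+ :0) refl
  sum-complements {suc n} a b = begin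
    (1# - p) * (1# - q) + sum (λ i → (1# - ι (a (suc i))) * (1# - ι (b (suc i))))
      ≈⟨ +-congˡ (sum-complements (a ∘ suc) (b ∘ suc)) ⟩
    (1# - p) * (1# - q) + (N - A - B + C)
      ≈⟨ solve 6 (λ p q n a b c → (:1 :- p) :* (:1 :- q) :+ (n :- a :- b :+ c)
            := :1 :+ n :- (p :+ a) :- (q :+ b) :+ (p :* q :+ c)) refl p q N A B C ⟩
    1# + N - (p + A) - (q + B) + (p * q + C)
      ≈⟨ +-congˡ (+-congʳ (ι-∧ (a zero) (b zero))) ⟨
    1# + N - (p + A) - (q + B) + (ι (a zero ∧ b zero) + C)
      ∎
    where
    p = ι (a zero)
    q = ι (b zero)
    N = nat n
    A = card (tabulate (a ∘ suc))
    B = card (tabulate (b ∘ suc))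
    C = card (tabulate (a ∘ suc) ∩ tabulate (b ∘ suc))

  degree : ∀ {n} → Adjacency n → Fin n → Carrier
  degree A v = card (neighbours A v)

  module Tight {n} (A : Adjacency n) (A-sym : Symmetric A) (A-irrefl : Irreflexive A)
    {x t : Carrier} (xt≈1 : x * t ≈ 1#) (0<t : 0# < t) (0≤dep : ∀ W → 0# ≤ dep A W t)
    (tight : nat n * x ≈ nat n * nat n - sum (degree A)) where

    open Expectation t

    private
      ⊤ₙ : Vec Bool n
      ⊤ₙ = Subset.⊤

      N mean : Carrier
      N = nat n
      mean = N * t

      𝔼 : (Vec Bool n → Carrier) → Carrier
      𝔼 = E A ⊤ₙ

      0≤weight : ∀ S → 0# ≤ weight t A ⊤ₙ S
      0≤weight = weight-nonneg (<⇒≤ 0<t) A 0≤dep ⊤ₙ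

      ι-⊤ : ∀ v → ι (lookup ⊤ₙ v) ≈ 1#
      ι-⊤ v = reflexive (≡.cong ι (Vec.lookup-replicate v true))

      𝔼-mem : ∀ v → 𝔼 (mem v) ≈ t
      𝔼-mem v = trans (E-mem A ⊤ₙ v) (trans (*-congʳ (ι-⊤ v)) (*-identityˡ t))

      𝔼-mem-card : ∀ v → 𝔼 (λ S → mem v S * card S) ≈ t * (1# + t * degree A v)
      𝔼-mem-card v = begin
        𝔼 (λ S → mem v S * card S)
          ≈⟨ E-mem-card A A-sym A-irrefl ⊤ₙ v ⟩
        ι (lookup ⊤ₙ v) * t * (1# + t * card (⊤ₙ ∩ neighbours A v))
          ≈⟨ *-cong (trans (*-congʳ (ι-⊤ v)) (*-identityˡ t))
               (+-congˡ (*-congˡ (reflexive (≡.cong card (Subset.∩-identityˡ (neighbours A v)))))) ⟩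
        t * (1# + t * degree A v)
          ∎

      -- One factor `card S` is expanded into membership indicators, so the second moment is the sum
      -- of `𝔼-mem-card` over all vertices.
      𝔼-card² : 𝔼 (λ S → card S * card S) ≈ N * t + t * t * sum (degree A)
      𝔼-card² = begin
        𝔼 (λ S → card S * card S)
          ≈⟨ E-cong A ⊤ₙ (λ S → trans (*-congʳ (card-sum S)) (*-distribʳ-sum (card S) (λ v → mem v S))) ⟩
        𝔼 (λ S → sum (λ v → mem v S * card S))
          ≈⟨ E-sum A ⊤ₙ (λ v S → mem v S * card S) ⟩
        sum (λ v → 𝔼 (λ S → mem v S * card S))
          ≈⟨ sum-cong-≋ (λ v → trans (𝔼-mem-card v)
               (solve 2 (λ t d → t :* (:1 :+ t :* d) := t :+ t :* t :* d) refl t (degree A v))) ⟩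
        sum (λ v → t + t * t * degree A v)
          ≈⟨ ∑-distrib-+ (λ _ → t) (λ v → t * t * degree A v) ⟩
        sum {n} (λ _ → t) + sum (λ v → t * t * degree A v)
          ≈⟨ +-cong (sum-const n t) (sym (*-distribˡ-sum (t * t) (degree A))) ⟩
        N * t + t * t * sum (degree A)
          ∎

      variance : 𝔼 (λ S → (card S - mean) * (card S - mean)) ≈ 0#
      variance = begin
        𝔼 (λ S → (card S - mean) * (card S - mean))
          ≈⟨ E-cong A ⊤ₙ (λ S → solve 2 (λ c m → (c :- m) :* (c :- m)
               := c :* c :+ (:- (m :+ m) :* c :+ m :* m :* :1)) refl (card S) mean) ⟩
        𝔼 (λ S → card S * card S + (- (mean + mean) * card S + mean * mean * 1#))
          ≈⟨ trans (E-+ A ⊤ₙ (λ S → card S * card S) (λ S → - (mean + mean) * card S + mean * mean * 1#))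
               (+-congˡ (trans (E-+ A ⊤ₙ (λ S → - (mean + mean) * card S) (λ _ → mean * mean * 1#))
                 (+-cong (E-* A ⊤ₙ (- (mean + mean)) card) (E-* A ⊤ₙ (mean * mean) (λ _ → 1#))))) ⟩
        𝔼 (λ S → card S * card S) + (- (mean + mean) * 𝔼 card + mean * mean * 𝔼 (λ _ → 1#))
          ≈⟨ +-cong 𝔼-card² (+-cong (*-congˡ (trans (E-card A ⊤ₙ) (*-congˡ (card-⊤ n)))) (*-congˡ (E-1 A ⊤ₙ))) ⟩
        N * t + t * t * K + (- (mean + mean) * (t * N) + mean * mean * 1#)
          ≈⟨ solve 3 (λ n t k → n :* t :+ t :* t :* k :+ (:- (n :* t :+ n :* t) :* (t :* n) :+ n :* t :* (n :* t) :* :1)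
               := n :* t :- t :* t :* (n :* n :- k)) refl N t K ⟩
        N * t - t * t * (N * N - K)
          -- The equality case enters here: once N² - 2k is replaced by `N * x`, one factor `t`
          -- cancels against `x` and the variance vanishes.
          ≈⟨ +-congˡ (-‿cong (*-congˡ tight)) ⟨
        N * t - t * t * (N * x)
          ≈⟨ solve 3 (λ n t x → n :* t :- t :* t :* (n :* x) := n :* t :- (x :* t) :* (n :* t)) refl N t x ⟩
        N * t - (x * t) * (N * t)
          ≈⟨ +-congˡ (-‿cong (trans (*-congʳ xt≈1) (*-identityˡ _))) ⟩
        N * t - N * t
          ≈⟨ -‿inverseʳ _ ⟩
        0#
          ∎
        where K = sum (degree A)

      -- The variance is a sum of nonnegative terms, so each of them vanishes, and in a field the
      -- square may be dropped.
      weight-concentrated : ∀ S → weight t A ⊤ₙ S * (card S - mean) ≈ 0#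
      weight-concentrated S with weight t A ⊤ₙ S ≈? 0#
      ... | yes w≈0 = trans (*-congʳ w≈0) (zeroˡ _)
      ... | no  w≉0 with (card S - mean) ≈? 0#
      ...   | yes d≈0 = trans (*-congˡ d≈0) (zeroʳ _)
      ...   | no  d≉0 = ⊥-elim (d≉0 (integral (integral
        (sumSubsets-≈0 (λ S → *-nonneg (0≤weight S) (square-nonneg (card S - mean))) variance S) w≉0) d≉0))

      -- The size agrees with its mean wherever the weight is nonzero.
      𝔼-card-const : ∀ f → 𝔼 (λ S → f S * card S) ≈ mean * 𝔼 f
      𝔼-card-const f = trans (sumSubsets-cong {n} pointwise) (sumSubsets-* {n} mean (λ S → weight t A ⊤ₙ S * f S))
        where
        pointwise : ∀ S → weight t A ⊤ₙ S * (f S * card S) ≈ mean * (weight t A ⊤ₙ S * f S)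
        pointwise S = begin
          w * (f S * card S)
            ≈⟨ solve 4 (λ w f c m → w :* (f :* c) := f :* (w :* (c :- m)) :+ m :* (w :* f)) refl w (f S) (card S) mean ⟩
          f S * (w * (card S - mean)) + mean * (w * f S)
            ≈⟨ +-congʳ (trans (*-congˡ (weight-concentrated S)) (zeroʳ _)) ⟩
          0# + mean * (w * f S)
            ≈⟨ +-identityˡ _ ⟩
          mean * (w * f S)
            ∎
          where w = weight t A ⊤ₙ S

    degree-const : ∀ v → degree A v ≈ N - x
    degree-const v = cancelˡ 0<t (begin
      t * d
        ≈⟨ solve 2 (λ t d → t :* d := :1 :+ t :* d :- :1) refl t d ⟩
      1# + t * d - 1#
        -- The two values t (1 + t d) and (N t) t of E(|X| [v ∈ X]), divided by `t`.
        ≈⟨ +-cong (cancelˡ 0<t (trans (sym (𝔼-mem-card v)) (trans (𝔼-card-const (mem v))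
             (trans (*-congˡ (𝔼-mem v)) (*-comm mean t))))) (-‿cong (sym xt≈1)) ⟩
      N * t - x * t
        ≈⟨ solve 3 (λ n t x → n :* t :- x :* t := t :* (n :- x)) refl N t x ⟩
      t * (N - x)
        ∎)
      where d = degree A v

    codegree-const : ∀ u v → A u v ≡ true → card (neighbours A u ∩ neighbours A v) ≈ N - x - x
    codegree-const u v uv = cancelˡ 0<t (begin
      t * d
        ≈⟨ solve 2 (λ t d → t :* d := :1 :+ :1 :+ t :* d :- :1 :- :1) refl t d ⟩
      1# + 1# + t * d - 1# - 1#
        ≈⟨ +-cong (+-cong tripled (-‿cong (sym xt≈1))) (-‿cong (sym xt≈1)) ⟩
      N * t - x * t - x * t
        ≈⟨ solve 3 (λ n t x → n :* t :- x :* t :- x :* t := t :* (n :- x :- x)) refl N t x ⟩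
      t * (N - x - x)
        ∎)
      where
      d = card (neighbours A u ∩ neighbours A v)

      u≢v : u ≢ v
      u≢v ≡.refl with () ← ≡.trans (≡.sym uv) (A-irrefl u)

      one³ : ι (lookup ⊤ₙ u) * ι (lookup ⊤ₙ v) * ι (A u v) ≈ 1#
      one³ = trans (*-cong (*-cong (ι-⊤ u) (ι-⊤ v)) (reflexive (≡.cong ι uv)))
        (solve 0 (:1 :* :1 :* :1 := :1) refl)

      -- The two values t² (2 + t d) and (N t) t² of E(|X| [u, v ∈ X]), divided by t².
      tripled : 1# + 1# + t * d ≈ N * t
      tripled = cancelˡ (*-pos 0<t 0<t) (begin
        t * t * (1# + 1# + t * d)
          ≈⟨ *-cong (trans (*-congʳ one³) (*-identityˡ (t * t)))
               (+-congˡ (*-congˡ (reflexive (≡.cong (λ V → card (V ∩ neighbours A v)) (Subset.∩-identityˡ (neighbours A u)))))) ⟨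
        ι (lookup ⊤ₙ u) * ι (lookup ⊤ₙ v) * ι (A u v) * (t * t) * (1# + 1# + t * card ((⊤ₙ ∩ neighbours A u) ∩ neighbours A v))
          ≈⟨ E-mem²-card A A-sym A-irrefl ⊤ₙ u v u≢v ⟨
        𝔼 (λ S → mem u S * mem v S * card S)
          ≈⟨ 𝔼-card-const (λ S → mem u S * mem v S) ⟩
        mean * 𝔼 (λ S → mem u S * mem v S)
          ≈⟨ *-congˡ (trans (E-mem² A A-sym ⊤ₙ u v u≢v) (trans (*-congʳ one³) (*-identityˡ (t * t)))) ⟩
        N * t * (t * t)
          ≈⟨ *-comm _ _ ⟩
        t * t * (N * t)
          ∎)

    -- The common nonneighbours of `u` and `v` number N - 2 (N - x) + (N - 2x) = 0.
    adjacent-dominates : ∀ u v → A u v ≡ true → ∀ w → A u w ≡ false → A v w ≡ true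
    adjacent-dominates u v uv w uw with A v w in vw
    ... | true  = ≡.refl
    ... | false = ⊥-elim (0≉1 (begin
      0#
        ≈⟨ sum-≈0 _ (λ i → *-nonneg (diff-nonneg (ι-≤1 (A u i))) (diff-nonneg (ι-≤1 (A v i)))) no-common-nonneighbour w ⟨
      (1# - ι (A u w)) * (1# - ι (A v w))
        ≡⟨ ≡.cong₂ (λ a b → (1# - ι a) * (1# - ι b)) uw vw ⟩
      (1# - 0#) * (1# - 0#)
        ≈⟨ solve 0 ((:1 :- :0) :* (:1 :- :0) := :1) refl ⟩
      1#
        ∎))
      where
      no-common-nonneighbour : sum (λ i → (1# - ι (A u i)) * (1# - ι (A v i))) ≈ 0#
      no-common-nonneighbour = begin
        sum (λ i → (1# - ι (A u i)) * (1# - ι (A v i)))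
          ≈⟨ sum-complements (A u) (A v) ⟩
        N - degree A u - degree A v + card (neighbours A u ∩ neighbours A v)
          ≈⟨ +-cong (+-cong (+-congˡ (-‿cong (degree-const u))) (-‿cong (degree-const v))) (codegree-const u v uv) ⟩
        N - (N - x) - (N - x) + (N - x - x)
          ≈⟨ solve 2 (λ n x → n :- (n :- x) :- (n :- x) :+ (n :- x :- x) := :0) refl N x ⟩
        0#
          ∎

  -- Complete multipartite graphs

  open MonoidSum *-commutativeMonoid using () renaming (sum to product; sum-cong-≋ to product-cong)

  δ : ∀ {p} → Fin p → Fin p → Carrier
  δ i j = ι (does (i ≟ᶠ j))

  δ-refl : ∀ {p} (i : Fin p) → δ i i ≈ 1#
  δ-refl i with i ≟ᶠ i
  ... | yes _   = refl
  ... | no  i≢i = ⊥-elim (i≢i ≡.refl)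

  δ-≢ : ∀ {p} {i j : Fin p} → i ≢ j → δ i j ≈ 0#
  δ-≢ {i = i} {j} i≢j with i ≟ᶠ j
  ... | yes i≡j = ⊥-elim (i≢j i≡j)
  ... | no  _   = refl

  -- A product is linear in its factor at `j₀`. This is the deletion recursion as it appears on the
  -- side of the factored polynomial.
  product-update : ∀ {p} (j₀ : Fin p) (f g h : Fin p → Carrier) k →
    (∀ j → j₀ ≢ j → f j ≈ g j) → (∀ j → j₀ ≢ j → h j ≈ g j) → f j₀ ≈ g j₀ - k → h j₀ ≈ 1# →
    product f ≈ product g - k * product h
  product-update zero f g h k f≈g h≈g f₀ h₀ = begin
    f zero * product (f ∘ suc)
      ≈⟨ *-cong f₀ (product-cong (λ j → f≈g (suc j) (λ ()))) ⟩
    (g zero - k) * product (g ∘ suc)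
      ≈⟨ solve 3 (λ g k p → (g :- k) :* p := g :* p :- k :* (:1 :* p)) refl (g zero) k _ ⟩
    g zero * product (g ∘ suc) - k * (1# * product (g ∘ suc))
      ≈⟨ +-congˡ (-‿cong (*-congˡ (*-cong h₀ (product-cong (λ j → h≈g (suc j) (λ ())))))) ⟨
    g zero * product (g ∘ suc) - k * (h zero * product (h ∘ suc))
      ∎
  product-update (suc j₀) f g h k f≈g h≈g f₀ h₀ = begin
    f zero * product (f ∘ suc)
      ≈⟨ *-cong (f≈g zero (λ ())) (product-update j₀ (f ∘ suc) (g ∘ suc) (h ∘ suc) k
           (λ j j₀≢j → f≈g (suc j) (j₀≢j ∘ suc-injective)) (λ j j₀≢j → h≈g (suc j) (j₀≢j ∘ suc-injective)) f₀ h₀) ⟩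
    g zero * (product (g ∘ suc) - k * product (h ∘ suc))
      ≈⟨ solve 4 (λ g p k q → g :* (p :- k :* q) := g :* p :- k :* (g :* q)) refl (g zero) _ k _ ⟩
    g zero * product (g ∘ suc) - k * (g zero * product (h ∘ suc))
      ≈⟨ +-congˡ (-‿cong (*-congˡ (*-congʳ (h≈g zero (λ ()))))) ⟨
    g zero * product (g ∘ suc) - k * (h zero * product (h ∘ suc))
      ∎

  product-const-≈0 : ∀ p {a} → product {p} (λ _ → a) ≈ 0# → a ≈ 0#
  product-const-≈0 zero    1≈0 = ⊥-elim (0≉1 (sym 1≈0))
  product-const-≈0 (suc p) {a} ≈0 with a ≈? 0#
  ... | yes a≈0 = a≈0
  ... | no  a≉0 = product-const-≈0 p (integral ≈0 a≉0)

  IsMultipartite : ∀ {n p} → Adjacency n → (Fin n → Fin p) → Set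
  IsMultipartite A f = ∀ u v → (A u v ≡ true → f u ≢ f v) × (f u ≢ f v → A u v ≡ true)

  multipartite-adjacency : ∀ {n p} (A : Adjacency n) (f : Fin n → Fin p) → IsMultipartite A f →
    ∀ u v → ι (A u v) ≈ 1# - δ (f u) (f v)
  multipartite-adjacency A f multi u v with f u ≟ᶠ f v | A u v in uv
  ... | yes fu≡fv | true  = ⊥-elim (proj₁ (multi u v) uv fu≡fv)
  ... | yes _     | false = sym (-‿inverseʳ 1#)
  ... | no  _     | true  = solve 0 (:1 := :1 :- :0) refl
  ... | no  fu≢fv | false with () ← ≡.trans (≡.sym uv) (proj₂ (multi u v) fu≢fv)

  partSize : ∀ {n p} → (Fin n → Fin p) → Vec Bool n → Fin p → Carrier
  partSize f []      j = 0#
  partSize f (b ∷ U) j = ι b * δ (f zero) j + partSize (f ∘ suc) U j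

  -- Passing to the neighbours of a vertex in part `i` empties that part and leaves the others
  -- intact.
  partSize-∩ : ∀ {n p} (f : Fin n → Fin p) U (a : Fin n → Bool) i →
    (∀ v → ι (a v) ≈ 1# - δ i (f v)) → ∀ j → partSize f (U ∩ tabulate a) j ≈ (1# - δ i j) * partSize f U j
  partSize-∩ f []      a i a≈ j = sym (zeroʳ _)
  partSize-∩ f (b ∷ U) a i a≈ j = begin
    ι (b ∧ a zero) * δ k j + partSize (f ∘ suc) (U ∩ tabulate (a ∘ suc)) j
      ≈⟨ +-cong (*-congʳ (trans (ι-∧ b (a zero)) (*-congˡ (a≈ zero)))) (partSize-∩ (f ∘ suc) U (a ∘ suc) i (a≈ ∘ suc) j) ⟩
    ι b * (1# - δ i k) * δ k j + (1# - δ i j) * partSize (f ∘ suc) U j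
      ≈⟨ +-congʳ (trans (*-assoc _ _ _) (*-congˡ replace)) ⟩
    ι b * ((1# - δ i j) * δ k j) + (1# - δ i j) * partSize (f ∘ suc) U j
      ≈⟨ solve 4 (λ b e d p → b :* (e :* d) :+ e :* p := e :* (b :* d :+ p)) refl (ι b) (1# - δ i j) (δ k j) _ ⟩
    (1# - δ i j) * (ι b * δ k j + partSize (f ∘ suc) U j)
      ∎
    where
    k = f zero
    -- Either `k` is `j`, or both sides carry the vanishing factor `δ k j`.
    replace : (1# - δ i k) * δ k j ≈ (1# - δ i j) * δ k j
    replace with k ≟ᶠ j
    ... | yes ≡.refl = refl
    ... | no  _      = trans (zeroʳ _) (sym (zeroʳ _))

  -- A clique takes at most one vertex from each part, so the sum factors over the parts. In the
  -- induction the first vertex, if in the mask, adds 1 to its own part, while restricting to its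
  -- neighbours turns the factor of that part into 1.
  dep-multipartite : ∀ {n p} (A : Adjacency n) (f : Fin n → Fin p) → IsMultipartite A f → ∀ U t →
    dep A U t ≈ product (λ j → 1# - t * partSize f U j)
  dep-multipartite {p = p} A f multi [] t = sym (product-1 p)
    where
    product-1 : ∀ p → product {p} (λ _ → 1# - t * 0#) ≈ 1#
    product-1 zero    = refl
    product-1 (suc p) = trans (*-congˡ (product-1 p)) (solve 1 (λ t → (:1 :- t :* :0) :* :1 := :1) refl t)
  dep-multipartite A f multi (b ∷ U) t = begin
    dep (inner A) U t - ι b * t * dep (inner A) (U ∩ neighbours₀ A) t
      ≈⟨ +-cong (IH U) (-‿cong (*-congˡ (trans (IH (U ∩ neighbours₀ A))
           (product-cong (λ j → +-congˡ (-‿cong (*-congˡ (partSize-∩ f′ U (A zero ∘ suc) (f zero)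
             (λ v → multipartite-adjacency A f multi zero (suc v)) j)))))))) ⟩
    product (λ j → 1# - t * partSize f′ U j) - ι b * t * product (λ j → 1# - t * ((1# - δ (f zero) j) * partSize f′ U j))
      ≈⟨ product-update (f zero)
           (λ j → 1# - t * (ι b * δ (f zero) j + partSize f′ U j))
           (λ j → 1# - t * partSize f′ U j)
           (λ j → 1# - t * ((1# - δ (f zero) j) * partSize f′ U j)) (ι b * t)
           (λ j f₀≢j → +-congˡ (-‿cong (*-congˡ (trans (+-congʳ (trans (*-congˡ (δ-≢ f₀≢j)) (zeroʳ _))) (+-identityˡ _)))))
           (λ j f₀≢j → +-congˡ (-‿cong (*-congˡ (trans (*-congʳ (+-congˡ (-‿cong (δ-≢ f₀≢j))))
             (solve 1 (λ p → (:1 :- :0) :* p := p) refl _)))))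
           (trans (+-congˡ (-‿cong (*-congˡ (+-congʳ (*-congˡ (δ-refl (f zero)))))))
             (solve 3 (λ t b p → :1 :- t :* (b :* :1 :+ p) := :1 :- t :* p :- b :* t) refl t (ι b) _))
           (trans (+-congˡ (-‿cong (*-congˡ (*-congʳ (+-congˡ (-‿cong (δ-refl (f zero))))))))
             (solve 2 (λ t p → :1 :- t :* ((:1 :- :1) :* p) := :1) refl t _)) ⟨
    product (λ j → 1# - t * (ι b * δ (f zero) j + partSize f′ U j))
      ∎
    where
    f′ = f ∘ suc
    IH = λ V → dep-multipartite (inner A) f′ (λ u v → multi (suc u) (suc v)) V t

  -- Comparison with PC and edge counting

  ∑ₗ : List Carrier → Carrier
  ∑ₗ = sumL R

  ∑ₗ-++ : ∀ xs ys → ∑ₗ (xs ++ ys) ≈ ∑ₗ xs + ∑ₗ ys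
  ∑ₗ-++ []       ys = sym (+-identityˡ _)
  ∑ₗ-++ (x ∷ xs) ys = trans (+-congˡ (∑ₗ-++ xs ys)) (sym (+-assoc _ _ _))

  ∑ₗ-cong : ∀ {A : Set} {f g : A → Carrier} {L} → All (λ a → f a ≈ g a) L → ∑ₗ (map f L) ≈ ∑ₗ (map g L)
  ∑ₗ-cong []        = refl
  ∑ₗ-cong (eq ∷ eqs) = +-cong eq (∑ₗ-cong eqs)

  ∑ₗ-concatMap : ∀ {A B : Set} (g : B → Carrier) (k : A → List B) L →
    ∑ₗ (map g (concatMap k L)) ≈ ∑ₗ (map (λ a → ∑ₗ (map g (k a))) L)
  ∑ₗ-concatMap g k []      = refl
  ∑ₗ-concatMap g k (a ∷ L) = begin
    ∑ₗ (map g (k a ++ concatMap k L))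
      ≡⟨ ≡.cong ∑ₗ (List.map-++ g (k a) (concatMap k L)) ⟩
    ∑ₗ (map g (k a) ++ map g (concatMap k L))
      ≈⟨ ∑ₗ-++ (map g (k a)) _ ⟩
    ∑ₗ (map g (k a)) + ∑ₗ (map g (concatMap k L))
      ≈⟨ +-congˡ (∑ₗ-concatMap g k L) ⟩
    ∑ₗ (map g (k a)) + ∑ₗ (map (λ a → ∑ₗ (map g (k a))) L)
      ∎

  ∑ₗ-tabulate : ∀ {A : Set} {n} (g : A → Carrier) (h : Fin n → A) → ∑ₗ (map g (List.tabulate h)) ≈ sum (g ∘ h)
  ∑ₗ-tabulate {n = zero}  g h = refl
  ∑ₗ-tabulate {n = suc n} g h = +-congˡ (∑ₗ-tabulate g (h ∘ suc))

  ∑ₗ-applyUpTo : ∀ {A : Set} (g : A → Carrier) (h : ℕ → A) k →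
    ∑ₗ (map g (applyUpTo h k)) ≈ sum {k} (λ i → g (h (toℕ i)))
  ∑ₗ-applyUpTo g h zero    = refl
  ∑ₗ-applyUpTo g h (suc k) = +-congˡ (∑ₗ-applyUpTo g (h ∘ suc) k)

  nat-length-filter : ∀ {A : Set} {P : A → Set} (P? : Decidable P) L →
    nat (length (filter P? L)) ≈ ∑ₗ (map (λ a → ι (does (P? a))) L)
  nat-length-filter P? []      = refl
  nat-length-filter P? (a ∷ L) with does (P? a)
  ... | true  = +-congˡ (nat-length-filter P? L)
  ... | false = trans (nat-length-filter P? L) (sym (+-identityˡ _))

  ∑ₗ-filter : ∀ {A : Set} {P : A → Set} (P? : Decidable P) (g : A → Carrier) L →
    ∑ₗ (map g (filter P? L)) ≈ ∑ₗ (map (λ a → ι (does (P? a)) * g a) L)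
  ∑ₗ-filter P? g []      = refl
  ∑ₗ-filter P? g (a ∷ L) with does (P? a)
  ... | true  = +-cong (sym (*-identityˡ _)) (∑ₗ-filter P? g L)
  ... | false = trans (∑ₗ-filter P? g L) (trans (sym (+-identityˡ _)) (+-congʳ (sym (zeroˡ _))))

  ∑ₗ-subsets : ∀ n (g : Vec Bool n → Carrier) → ∑ₗ (map g (subsets n)) ≈ sumSubsets g
  ∑ₗ-subsets zero    g = +-identityʳ _
  ∑ₗ-subsets (suc n) g = begin
    ∑ₗ (map g (map (false ∷_) (subsets n) ++ map (true ∷_) (subsets n)))
      ≡⟨ ≡.cong ∑ₗ (≡.trans (List.map-++ g (map (false ∷_) (subsets n)) _)
           (≡.cong₂ _++_ (≡.sym (List.map-∘ (subsets n))) (≡.sym (List.map-∘ (subsets n))))) ⟩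
    ∑ₗ (map (g ∘ (false ∷_)) (subsets n) ++ map (g ∘ (true ∷_)) (subsets n))
      ≈⟨ ∑ₗ-++ (map (g ∘ (false ∷_)) (subsets n)) _ ⟩
    ∑ₗ (map (g ∘ (false ∷_)) (subsets n)) + ∑ₗ (map (g ∘ (true ∷_)) (subsets n))
      ≈⟨ +-cong (∑ₗ-subsets n _) (∑ₗ-subsets n _) ⟩
    sumSubsets (g ∘ (false ∷_)) + sumSubsets (g ∘ (true ∷_))
      ∎

  sum-select : ∀ k (g : ℕ → Carrier) s → s ℕ.< k → sum {k} (λ i → ι (does (s ℕ.≟ toℕ i)) * g (toℕ i)) ≈ g s
  sum-select (suc k) g zero    _         = begin
    1# * g 0 + sum {k} (λ i → 0# * g (suc (toℕ i)))
      ≈⟨ +-cong (*-identityˡ _) (trans (sum-cong-≋ {k} (λ i → zeroˡ (g (suc (toℕ i))))) (sum-replicate-zero k)) ⟩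
    g 0 + 0#
      ≈⟨ +-identityʳ _ ⟩
    g 0
      ∎
  sum-select (suc k) g (suc s) (s≤s s<k) = trans (+-cong (zeroˡ _) (sum-select k (g ∘ suc) s s<k)) (+-identityˡ _)

  -- Each `S` contributes at exactly one index, its size, which the bound `k` keeps in range.
  sum-by-size : ∀ {n} k (a b : ℕ → Carrier) {L : List (Vec Bool n)} → All (λ S → size S ℕ.≤ k) L →
    sum {suc k} (λ i → a (toℕ i) * (nat (length (filter (λ S → size S ℕ.≟ toℕ i) L)) * b (toℕ i)))
      ≈ ∑ₗ (map (λ S → a (size S) * b (size S)) L)
  sum-by-size k a b [] = trans
    (sum-cong-≋ {suc k} (λ i → solve 2 (λ a b → a :* (:0 :* b) := :0) refl (a (toℕ i)) (b (toℕ i))))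
    (sum-replicate-zero (suc k))
  sum-by-size k a b {S ∷ L} (|S|≤k ∷ ≤k) = begin
    sum {suc k} (λ i → a (toℕ i) * (count (S ∷ L) i * b (toℕ i)))
      ≈⟨ sum-cong-≋ {suc k} (λ i → trans (*-congˡ (*-congʳ (count-∷ i)))
           (solve 4 (λ a b d c → a :* ((d :+ c) :* b) := d :* (a :* b) :+ a :* (c :* b)) refl
             (a (toℕ i)) (b (toℕ i)) (ι (does (size S ℕ.≟ toℕ i))) (count L i))) ⟩
    sum {suc k} (λ i → ι (does (size S ℕ.≟ toℕ i)) * (a (toℕ i) * b (toℕ i)) + a (toℕ i) * (count L i * b (toℕ i)))
      ≈⟨ ∑-distrib-+ {suc k} (λ i → ι (does (size S ℕ.≟ toℕ i)) * (a (toℕ i) * b (toℕ i)))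
           (λ i → a (toℕ i) * (count L i * b (toℕ i))) ⟩
    sum {suc k} (λ i → ι (does (size S ℕ.≟ toℕ i)) * (a (toℕ i) * b (toℕ i))) + sum {suc k} (λ i → a (toℕ i) * (count L i * b (toℕ i)))
      ≈⟨ +-cong (sum-select (suc k) (λ i → a i * b i) (size S) (s≤s |S|≤k)) (sum-by-size k a b ≤k) ⟩
    a (size S) * b (size S) + ∑ₗ (map (λ S → a (size S) * b (size S)) L)
      ∎
    where
    count : List (Vec Bool _) → Fin (suc k) → Carrier
    count L i = nat (length (filter (λ S → size S ℕ.≟ toℕ i) L))

    count-∷ : ∀ i → count (S ∷ L) i ≈ ι (does (size S ℕ.≟ toℕ i)) + count L i
    count-∷ i with does (size S ℕ.≟ toℕ i)
    ... | true  = refl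
    ... | false = sym (+-identityˡ _)

  dep-sum : ∀ {n} (A : Adjacency n) U t → dep A U t ≈ sumSubsets (λ S → ι (isClique A U S) * pow R (- t) (size S))
  dep-sum A []      t = sym (*-identityˡ 1#)
  dep-sum {suc n} A (b ∷ U) t = begin
    dep (inner A) U t - ι b * t * dep (inner A) UN t
      ≈⟨ +-cong (dep-sum (inner A) U t) (trans (solve 3 (λ b t d → :- (b :* t :* d) := b :* :- t :* d) refl (ι b) t _)
           (*-congˡ (dep-sum (inner A) UN t))) ⟩
    sumSubsets (λ S → ι (isClique (inner A) U S) * pow R (- t) (size S))
      + ι b * - t * sumSubsets (λ S → ι (isClique (inner A) UN S) * pow R (- t) (size S))
      ≈⟨ +-congˡ (trans (sym (sumSubsets-* {n} (ι b * - t) (λ S → ι (isClique (inner A) UN S) * pow R (- t) (size S))))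
           (sumSubsets-cong {n} (λ S → trans
             (solve 4 (λ b t i p → b :* t :* (i :* p) := b :* i :* (t :* p)) refl (ι b) (- t) (ι (isClique (inner A) UN S)) (pow R (- t) (size S)))
             (*-congʳ (sym (ι-∧ b (isClique (inner A) UN S))))))) ⟩
    sumSubsets (λ S → ι (isClique (inner A) U S) * pow R (- t) (size S))
      + sumSubsets (λ S → ι (b ∧ isClique (inner A) UN S) * (- t * pow R (- t) (size S)))
      ∎
    where UN = U ∩ neighbours₀ A

  -- Each of the `s` signs is rewritten as `- (y * t)`, which restores one missing factor `y` and
  -- leaves one factor `- t`.
  pow-∸ : ∀ {y t} → y * t ≈ 1# → ∀ m s → s ℕ.≤ m → pow R (- 1#) s * pow R y (m ∸ s) ≈ pow R y m * pow R (- t) s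
  pow-∸ yt≈1 m       zero    _         = *-comm 1# _
  pow-∸ {y} {t} yt≈1 (suc m) (suc s) (s≤s s≤m) = begin
    - 1# * pow R (- 1#) s * pow R y (m ∸ s)
      ≈⟨ *-assoc _ _ _ ⟩
    - 1# * (pow R (- 1#) s * pow R y (m ∸ s))
      ≈⟨ *-congˡ (pow-∸ yt≈1 m s s≤m) ⟩
    - 1# * (pow R y m * pow R (- t) s)
      ≈⟨ *-congʳ (-‿cong (sym yt≈1)) ⟩
    - (y * t) * (pow R y m * pow R (- t) s)
      ≈⟨ solve 4 (λ y t p q → :- (y :* t) :* (p :* q) := y :* p :* (:- t :* q)) refl y t _ _ ⟩
    y * pow R y m * (- t * pow R (- t) s)
      ∎

  pow-pos : ∀ {y} → 0# < y → ∀ m → 0# < pow R y m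
  pow-pos 0<y zero    = 0<1
  pow-pos 0<y (suc m) = *-pos 0<y (pow-pos 0<y m)

  -- The power of `y` is nonzero here, so the nonzero roots of PC are the reciprocals of the roots
  -- of D.
  PC≈dep : ∀ {n} (G : Graph n) {y t} → y * t ≈ 1# → PC R G y ≈ pow R y (ω G) * dep (adj G) Subset.⊤ t
  PC≈dep {n} G {y} {t} yt≈1 = begin
    PC R G y
      ≈⟨ ∑ₗ-applyUpTo (λ i → a i * (nat (Defs.c G i) * b i)) id (suc (ω G)) ⟩
    sum {suc (ω G)} (λ i → a (toℕ i) * (nat (Defs.c G (toℕ i)) * b (toℕ i)))
      ≈⟨ sum-by-size (ω G) a b (size≤ω G) ⟩
    ∑ₗ (map (λ S → a (size S) * b (size S)) (cliques G))
      ≈⟨ ∑ₗ-cong (All.map (λ {S} → pow-∸ yt≈1 (ω G) (size S)) (size≤ω G)) ⟩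
    ∑ₗ (map (λ S → pow R y (ω G) * pow R (- t) (size S)) (cliques G))
      ≈⟨ ∑ₗ-filter (λ S → T? (isCliqueᵇ G S)) (λ S → pow R y (ω G) * pow R (- t) (size S)) (subsets n) ⟩
    ∑ₗ (map (λ S → ι (isCliqueᵇ G S) * (pow R y (ω G) * pow R (- t) (size S))) (subsets n))
      ≈⟨ ∑ₗ-subsets n (λ S → ι (isCliqueᵇ G S) * (pow R y (ω G) * pow R (- t) (size S))) ⟩
    sumSubsets (λ S → ι (isCliqueᵇ G S) * (pow R y (ω G) * pow R (- t) (size S)))
      ≈⟨ sumSubsets-cong {n} (λ S → trans (*-congʳ (reflexive (≡.cong ι (≡.sym (isClique≡isCliqueᵇ G S)))))
           (solve 3 (λ i p q → i :* (p :* q) := p :* (i :* q)) refl (ι (isClique (adj G) Subset.⊤ S)) (pow R y (ω G)) (pow R (- t) (size S)))) ⟩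
    sumSubsets (λ S → pow R y (ω G) * (ι (isClique (adj G) Subset.⊤ S) * pow R (- t) (size S)))
      ≈⟨ sumSubsets-* {n} (pow R y (ω G)) (λ S → ι (isClique (adj G) Subset.⊤ S) * pow R (- t) (size S)) ⟩
    pow R y (ω G) * sumSubsets (λ S → ι (isClique (adj G) Subset.⊤ S) * pow R (- t) (size S))
      ≈⟨ *-congˡ (dep-sum (adj G) Subset.⊤ t) ⟨
    pow R y (ω G) * dep (adj G) Subset.⊤ t
      ∎
    where
    a b : ℕ → Carrier
    a i = pow R (- 1#) i
    b i = pow R y (ω G ∸ i)

  card-tabulate : ∀ {n} (a : Fin n → Bool) → card (tabulate a) ≈ sum (λ i → ι (a i))
  card-tabulate {zero}  a = refl
  card-tabulate {suc n} a = +-congˡ (card-tabulate (a ∘ suc))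

  <ᵇ-connex : ∀ m n → m ≢ n → ι (m ℕ.<ᵇ n) + ι (n ℕ.<ᵇ m) ≈ 1#
  <ᵇ-connex zero    zero    0≢0 = ⊥-elim (0≢0 ≡.refl)
  <ᵇ-connex zero    (suc n) _   = +-identityʳ 1#
  <ᵇ-connex (suc m) zero    _   = +-identityˡ 1#
  <ᵇ-connex (suc m) (suc n) m≢n = <ᵇ-connex m n (m≢n ∘ ≡.cong suc)

  -- `numEdges` counts the pairs with u < v. Exchanging the summations in one of two copies makes
  -- each edge appear once from either end.
  handshake : ∀ {n} (G : Graph n) → nat (2 ℕ.* numEdges G) ≈ sum (degree (adj G))
  handshake {n} G = begin
    nat (2 ℕ.* numEdges G)
      ≈⟨ nat-+ (numEdges G) (numEdges G ℕ.+ 0) ⟩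
    nat (numEdges G) + nat (numEdges G ℕ.+ 0)
      ≈⟨ +-cong edges (trans (reflexive (≡.cong nat (ℕ.+-identityʳ (numEdges G)))) (trans edges (∑-comm {n} {n} oriented))) ⟩
    sum (λ u → sum (λ v → oriented u v)) + sum (λ u → sum (λ v → oriented v u))
      ≈⟨ ∑-distrib-+ {n} (λ u → sum (λ v → oriented u v)) (λ u → sum (λ v → oriented v u)) ⟨
    sum (λ u → sum (λ v → oriented u v) + sum (λ v → oriented v u))
      ≈⟨ sum-cong-≋ {n} (λ u → trans (sym (∑-distrib-+ {n} (λ v → oriented u v) (λ v → oriented v u)))
           (trans (sum-cong-≋ {n} (both u)) (sym (card-tabulate (adj G u))))) ⟩
    sum (degree (adj G))
      ∎
    where
    oriented : Fin n → Fin n → Carrier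
    oriented u v = ι ((toℕ u ℕ.<ᵇ toℕ v) ∧ adj G u v)

    edges : nat (numEdges G) ≈ sum (λ u → sum (λ v → oriented u v))
    edges = begin
      nat (numEdges G)
        ≈⟨ nat-length-filter (λ p → T? ((toℕ (proj₁ p) ℕ.<ᵇ toℕ (proj₂ p)) ∧ adj G (proj₁ p) (proj₂ p)))
             (concatMap (λ u → map (u ,_) (allFin n)) (allFin n)) ⟩
      ∑ₗ (map (λ p → oriented (proj₁ p) (proj₂ p)) (concatMap (λ u → map (u ,_) (allFin n)) (allFin n)))
        ≈⟨ ∑ₗ-concatMap (λ p → oriented (proj₁ p) (proj₂ p)) (λ u → map (u ,_) (allFin n)) (allFin n) ⟩
      ∑ₗ (map (λ u → ∑ₗ (map (λ p → oriented (proj₁ p) (proj₂ p)) (map (u ,_) (allFin n)))) (allFin n))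
        ≈⟨ ∑ₗ-tabulate {n = n} (λ u → ∑ₗ (map (λ p → oriented (proj₁ p) (proj₂ p)) (map (u ,_) (allFin n)))) id ⟩
      sum (λ u → ∑ₗ (map (λ p → oriented (proj₁ p) (proj₂ p)) (map (u ,_) (allFin n))))
        ≈⟨ sum-cong-≋ {n} (λ u → trans (reflexive (≡.cong ∑ₗ (≡.sym (List.map-∘ (allFin n))))) (∑ₗ-tabulate (oriented u) id)) ⟩
      sum (λ u → sum (λ v → oriented u v))
        ∎

    both : ∀ u v → oriented u v + oriented v u ≈ ι (adj G u v)
    both u v rewrite Graph.sym G v u with adj G u v in uv
    ... | false rewrite Bool.∧-zeroʳ (toℕ u ℕ.<ᵇ toℕ v) | Bool.∧-zeroʳ (toℕ v ℕ.<ᵇ toℕ u) = +-identityˡ 0#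
    ... | true  rewrite Bool.∧-identityʳ (toℕ u ℕ.<ᵇ toℕ v) | Bool.∧-identityʳ (toℕ v ℕ.<ᵇ toℕ u) =
      <ᵇ-connex (toℕ u) (toℕ v) (λ u≡v → u≢v (toℕ-injective u≡v))
      where
      u≢v : u ≢ v
      u≢v ≡.refl with () ← ≡.trans (≡.sym uv) (Graph.irrefl G u)

  sum-complement : ∀ {n} (a : Fin n → Bool) → sum (λ i → 1# - ι (a i)) ≈ nat n - card (tabulate a)
  sum-complement {zero}  a = sym (-‿inverseʳ 0#)
  sum-complement {suc n} a = trans (+-congˡ (sum-complement (a ∘ suc)))
    (solve 3 (λ i n c → :1 :- i :+ (n :- c) := :1 :+ n :- (i :+ c)) refl (ι (a zero)) _ _)

  sum-mono : ∀ {n} (f g : Fin n → Carrier) → (∀ i → f i ≤ g i) → sum f ≤ sum g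
  sum-mono {zero}  f g f≤g = ≤-refl
  sum-mono {suc n} f g f≤g = +-mono (f≤g zero) (sum-mono (f ∘ suc) (g ∘ suc) (f≤g ∘ suc))

  term≤sum : ∀ {n} (f : Fin n → Carrier) → (∀ i → 0# ≤ f i) → ∀ i → f i ≤ sum f
  term≤sum f 0≤f zero    = ≤-respˡ (+-identityʳ _) (+-mono ≤-refl (sum-nonneg (f ∘ suc) (0≤f ∘ suc)))
  term≤sum f 0≤f (suc i) = ≤-respˡ (+-identityˡ _) (+-mono (0≤f zero) (term≤sum (f ∘ suc) (0≤f ∘ suc) i))

  -- Used with `a` the neighbourhood of `u`: the nonneighbour counted is `u` itself.
  1≤sum-complement : ∀ {n} (a : Fin n → Bool) u → a u ≡ false → 1# ≤ nat n - card (tabulate a)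
  1≤sum-complement a u au = ≤-respˡ
    (trans (+-congˡ (-‿cong (reflexive (≡.cong ι au)))) (trans (+-congˡ -0#≈0#) (+-identityʳ 1#)))
    (≤-respʳ (sum-complement a) (term≤sum (λ i → 1# - ι (a i)) (λ i → diff-nonneg (ι-≤1 (a i))) u))

  fibre-size : ∀ {n p} (f : Fin n → Fin p) j → nat (length (filter (λ v → f v ≟ᶠ j) (allFin n))) ≈ sum (λ v → δ (f v) j)
  fibre-size {n} f j = trans (nat-length-filter (λ v → f v ≟ᶠ j) (allFin n)) (∑ₗ-tabulate (λ v → δ (f v) j) id)

  partSize-⊤ : ∀ {n p} (f : Fin n → Fin p) j → partSize f Subset.⊤ j ≈ sum (λ v → δ (f v) j)
  partSize-⊤ {zero}  f j = refl
  partSize-⊤ {suc n} f j = +-cong (*-identityˡ _) (partSize-⊤ (f ∘ suc) j)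

  -- The two implications.

  module _ {m} (G : Graph (suc m)) {x : Carrier}
    (nx≈ : nat (suc m) * x ≈ nat (suc m ℕ.* suc m) - nat (2 ℕ.* numEdges G)) where

    private
      n = suc m
      A = adj G
      N = nat n

      tight : N * x ≈ N * N - sum (degree A)
      tight = trans nx≈ (+-cong (nat-* n n) (-‿cong (handshake G)))

    -- `x` is the average of the numbers `N - degree A u`, each at least 1. Hence its reciprocal
    -- lies in [0, 1], the range covered by `Lipschitz`.
    1≤x : 1# ≤ x
    1≤x = cancelˡ-≤ (0<nat-suc m) (≤-respˡ (sum-const n 1#) (≤-respʳ
      (begin
        sum {n} (λ u → N - degree A u)
          ≈⟨ solve 2 (λ s k → s := s :+ k :- k) refl _ (sum (degree A)) ⟩
        sum {n} (λ u → N - degree A u) + sum (degree A) - sum (degree A)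
          ≈⟨ +-congʳ (∑-distrib-+ {n} (λ u → N - degree A u) (degree A)) ⟨
        sum {n} (λ u → N - degree A u + degree A u) - sum (degree A)
          ≈⟨ +-congʳ (trans (sum-cong-≋ {n} (λ u → solve 2 (λ n d → n :- d :+ d := n) refl N (degree A u))) (sum-const n N)) ⟩
        N * N - sum (degree A)
          ≈⟨ tight ⟨
        N * x
          ∎)
      (sum-mono {n} (λ _ → 1#) (λ u → N - degree A u) (λ u → 1≤sum-complement (A u) u (Graph.irrefl G u)))))

    0<x : 0# < x
    0<x = <-≤-trans 0<1 1≤x

    -- Strict positivity below `t` passes from `G` to its induced subgraphs; at `t`, which may
    -- itself be a root, only the limit remains.
    dep-nonneg : (∀ y → PC R G y ≈ 0# → y ≤ x) → ∀ {t} → x * t ≈ 1# → ∀ W → 0# ≤ dep A W t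
    dep-nonneg largest {t} xt≈1 W = nonneg-closure (dep-lipschitz A W) (0<dep-0 A W) 0≤t t≤1
      (≡.subst (λ V → PositiveBelow (dep A V) t) (Subset.∩-identityˡ W)
        (dep-positive-∩ A (Graph.sym G) (Graph.irrefl G) (size ⊤ₙ) ⊤ₙ W ℕ.≤-refl t≤1 below))
      where
      ⊤ₙ : Vec Bool n
      ⊤ₙ = Subset.⊤

      0≤t : 0# ≤ t
      0≤t = <⇒≤ (pos-factor 0<x (λ xt≤0 → 0<1 (≤-respˡ xt≈1 xt≤0)))

      t≤1 : t ≤ 1#
      t≤1 = cancelˡ-≤ 0<x (≤-respˡ (sym xt≈1) (≤-respʳ (sym (*-identityʳ x)) 1≤x))

      -- A root `s` is not 0, since D is 1 there. Its reciprocal is a root of PC, hence at most `x`,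
      -- which means `t ≤ s`.
      no-root : ∀ s → 0# ≤ s → dep A ⊤ₙ s ≈ 0# → t ≤ s
      no-root s 0≤s ds≈0 with s ≈? 0#
      ... | yes s≈0 = ⊥-elim (<⇒≉ 0<1 (begin
        1#                  ≈⟨ dep-0 A ⊤ₙ ⟨
        dep A ⊤ₙ 0#         ≈⟨ dep-resp A ⊤ₙ s≈0 ⟨
        dep A ⊤ₙ s          ≈⟨ ds≈0 ⟩
        0#                  ∎))
      ... | no  s≉0 with inverse s s≉0
      ...   | (y , sy≈1) = cancelˡ-≤ 0<x (≤-respˡ (trans (*-comm s y) (trans ys≈1 (sym xt≈1)))
                (≤-respʳ (*-comm s x) (*-monoˡ 0≤s (largest y (trans (PC≈dep G ys≈1) (trans (*-congˡ ds≈0) (zeroʳ _)))))))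
        where
        ys≈1 : y * s ≈ 1#
        ys≈1 = trans (*-comm y s) sy≈1

      below : PositiveBelow (dep A ⊤ₙ) t
      below r 0≤r r<t d≤0 =
        let (s , 0≤s , s≤r , ds≈0 , _) = first-root (dep-lipschitz A ⊤ₙ) (0<dep-0 A ⊤ₙ) r 0≤r (≤-trans (<⇒≤ r<t) t≤1) d≤0
        in r<t (≤-trans (no-root s 0≤s ds≈0) s≤r)

    private
      multipartite-from-inverse : (∀ y → PC R G y ≈ 0# → y ≤ x) → ∀ {t} → x * t ≈ 1# → EqualCompleteMultipartite G
      multipartite-from-inverse largest {t} xt≈1 =
        -- The class of vertex `zero`, which exists in a graph on `suc m` vertices, supplies the
        -- common size. All classes count to `x` in the field, so their sizes agree as naturals.
        Q.classes , length (filter (λ v → Q.class v ≟ᶠ Q.class zero) (allFin n)) , Q.class ,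
        (λ u v → (λ uv eq → true≢false (≡.trans (≡.sym uv) (Q.effective u v eq))) , λ fu≢fv → Bool.¬-not (λ uv → fu≢fv (Q.sound u v uv))) ,
        λ j → nat-injective (trans (class-size j) (sym (class-size (Q.class zero))))
        where
        open Tight A (Graph.sym G) (Graph.irrefl G) xt≈1
          (pos-factor 0<x (λ xt≤0 → 0<1 (≤-respˡ xt≈1 xt≤0))) (dep-nonneg largest xt≈1) tight

        true≢false : true ≢ false
        true≢false ()

        nonadjacent : Fin n → Fin n → Set
        nonadjacent u v = A u v ≡ false

        nonadjacent-trans : ∀ {u v w} → nonadjacent u v → nonadjacent v w → nonadjacent u w
        nonadjacent-trans {u} {v} {w} uv vw with A u w in uw
        ... | false = ≡.refl
        ... | true  = ⊥-elim (true≢false (≡.trans (≡.sym (adjacent-dominates u w uw v uv)) (≡.trans (Graph.sym G w v) vw)))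

        Q = quotient {n} {nonadjacent}
          (record { refl = λ {u} → Graph.irrefl G u ; sym = λ {u} {v} uv → ≡.trans (Graph.sym G v u) uv ; trans = nonadjacent-trans })
          (λ u v → A u v Bool.≟ false)
        module Q = Quotient Q

        class-size : ∀ j → nat (length (filter (λ v → Q.class v ≟ᶠ j) (allFin n))) ≈ x
        class-size j with Q.surjective j
        ... | (u , ≡.refl) = begin
          nat (length (filter (λ v → Q.class v ≟ᶠ Q.class u) (allFin n)))
            ≈⟨ fibre-size Q.class (Q.class u) ⟩
          sum (λ v → δ (Q.class v) (Q.class u))
            ≈⟨ sum-cong-≋ {n} same-class ⟩
          sum (λ v → 1# - ι (A u v))
            ≈⟨ sum-complement (A u) ⟩
          N - degree A u
            ≈⟨ +-congˡ (-‿cong (degree-const u)) ⟩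
          N - (N - x)
            ≈⟨ solve 2 (λ n x → n :- (n :- x) := x) refl N x ⟩
          x
            ∎
          where
          same-class : ∀ v → δ (Q.class v) (Q.class u) ≈ 1# - ι (A u v)
          same-class v with A u v in uv
          ... | false = trans (reflexive (≡.cong (λ j → δ j (Q.class u)) (≡.sym (Q.sound u v uv))))
            (trans (δ-refl (Q.class u)) (solve 0 (:1 := :1 :- :0) refl))
          ... | true  = trans (δ-≢ (λ eq → true≢false (≡.trans (≡.sym uv) (Q.effective u v (≡.sym eq))))) (sym (-‿inverseʳ 1#))

    largest-root⇒multipartite : (∀ y → PC R G y ≈ 0# → y ≤ x) → EqualCompleteMultipartite G
    largest-root⇒multipartite largest = multipartite-from-inverse largest (proj₂ (inverse x (<⇒≉ 0<x)))

    multipartite⇒largest-root : EqualCompleteMultipartite G → IsLargestRoot R G x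
    multipartite⇒largest-root (p , s , f , multi , sizes) = root , largest
      where
      size-sum : ∀ j → sum (λ v → δ (f v) j) ≈ nat s
      size-sum j = trans (sym (fibre-size f j)) (reflexive (≡.cong nat (sizes j)))

      degree≈ : ∀ u → degree A u ≈ N - nat s
      degree≈ u = begin
        degree A u
          ≈⟨ solve 2 (λ d n → d := n :- (n :- d)) refl (degree A u) N ⟩
        N - (N - degree A u)
          ≈⟨ +-congˡ (-‿cong (sum-complement (A u))) ⟨
        N - sum (λ v → 1# - ι (A u v))
          ≈⟨ +-congˡ (-‿cong (sum-cong-≋ {n} (λ v → trans (+-congˡ (-‿cong
               (trans (reflexive (≡.cong ι (Graph.sym G u v))) (multipartite-adjacency A f multi v u))))
               (solve 1 (λ d → :1 :- (:1 :- d) := d) refl (δ (f v) (f u)))))) ⟩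
        N - sum (λ v → δ (f v) (f u))
          ≈⟨ +-congˡ (-‿cong (size-sum (f u))) ⟩
        N - nat s
          ∎

      -- All degrees are n - s, so the average number of nonneighbours, which is `x`, equals the
      -- part size.
      x≈s : x ≈ nat s
      x≈s = cancelˡ (0<nat-suc m) (begin
        N * x
          ≈⟨ tight ⟩
        N * N - sum (degree A)
          ≈⟨ +-congˡ (-‿cong (trans (sum-cong-≋ {n} degree≈) (sum-const n (N - nat s)))) ⟩
        N * N - N * (N - nat s)
          ≈⟨ solve 2 (λ n s → n :* n :- n :* (n :- s) := n :* s) refl N (nat s) ⟩
        N * nat s
          ∎)

      factored : ∀ {y t} → y * t ≈ 1# → PC R G y ≈ pow R y (ω G) * product {p} (λ _ → 1# - t * x)
      factored {y} {t} yt≈1 = trans (PC≈dep G yt≈1) (*-congˡ (trans (dep-multipartite A f multi Subset.⊤ t)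
        (product-cong {p} (λ j → +-congˡ (-‿cong (*-congˡ (trans (partSize-⊤ f j) (trans (size-sum j) (sym x≈s)))))))))

      root : PC R G x ≈ 0#
      root =
        let (t , xt≈1) = inverse x (<⇒≉ 0<x)
        -- The index `f zero` witnesses that there is at least one part, so the product really has a
        -- vanishing factor.
        in trans (factored xt≈1) (trans (*-congˡ (product-≈0 (f zero)
             (trans (+-congˡ (-‿cong (trans (*-comm t x) xt≈1))) (-‿inverseʳ 1#)))) (zeroʳ _))
        where
        product-≈0 : ∀ {p} {a} → Fin p → a ≈ 0# → product {p} (λ _ → a) ≈ 0#
        product-≈0 {suc p} _ a≈0 = trans (*-congʳ a≈0) (zeroˡ _)

      largest : ∀ y → PC R G y ≈ 0# → y ≤ x
      -- Splitting off `y ≤ 0#` first disposes of `y ≈ 0#`, where no reciprocal is available. A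
      -- positive root must equal `x`.
      largest y Py≈0 with ≤⊎> y 0#
      ... | inj₁ y≤0 = ≤-trans y≤0 (<⇒≤ 0<x)
      ... | inj₂ 0<y with inverse y (<⇒≉ 0<y)
      ...   | (t , yt≈1) = ≤-reflexive (begin
        y
          ≈⟨ *-identityʳ y ⟨
        y * 1#
          ≈⟨ *-congˡ (solve 1 (λ a → :1 := :1 :- a :+ a) refl (t * x)) ⟩
        y * (1# - t * x + t * x)
          ≈⟨ *-congˡ (+-congʳ (product-const-≈0 p (integral (trans (sym (factored yt≈1)) Py≈0) (<⇒≉ (pow-pos 0<y (ω G)))))) ⟩
        y * (0# + t * x)
          ≈⟨ solve 3 (λ y t x → y :* (:0 :+ t :* x) := y :* t :* x) refl y t x ⟩
        y * t * x
          ≈⟨ trans (*-congʳ yt≈1) (*-identityˡ x) ⟩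
        x
          ∎)

open import Data.Nat using (_*_)

theorem7p1 : (R : CompleteOrderedField) → (m : ℕ) → (G : Graph (suc m)) →
    (x : CompleteOrderedField.Carrier R) →
    CompleteOrderedField._≈_ R
    (CompleteOrderedField._*_ R (fromℕ R (suc m)) x)
    (CompleteOrderedField._-_ R (fromℕ R (suc m * suc m)) (fromℕ R (2 * numEdges G))) →
    (IsLargestRoot R G x ⇔ (Edgeless G ⊎ EqualCompleteMultipartite G))
theorem7p1 R m G x nx≈ = mk⇔
  -- An edgeless graph has one part of full size, so the second alternative can always be the
  -- answer.
  (λ (_ , largest) → inj₂ (largest-root⇒multipartite G nx≈ largest))
  [ multipartite⇒largest-root G nx≈ ∘ edgeless⇒multipartite G , multipartite⇒largest-root G nx≈ ]′
  where open CliquePolynomial R
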